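{- Let $n>1$ be an integer with $n\equiv1\pmod4$. Then $n$ is not a sum of two squares of integers if and only if $$\sum_{x=0}^{n-1}\left(\frac{x(x^2+1)}n\right)=0.$$
   Context: $\left(\frac{\cdot}{n}\right)$ denotes the Jacobi symbol modulo the odd integer $n$ (equal to $0$ on integers not coprime to $n$). -}

module Defs where

open import Data.Nat using (ℕ; zero; suc; _*_; _%_; _≡ᵇ_)
open import Data.Nat.Divisibility using (_∣?_)
open import Data.Nat.Primality.Factorisation using (factorise; factors)
open import Data.Integer as ℤ using (ℤ; +_; -[1+_])
open import Data.List using (List; []; _∷_; upTo; map; foldr)
open import Data.Bool.ListAction using (any)
open import Data.Bool using (Bool; true; false; if_then_else_)
open import Relation.Nullary.Decidable using (does)

-- Residue of a modulo p (p = 0 never arises below; fallback only for totality).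
_mod_ : ℕ → ℕ → ℕ
a mod zero = a
a mod suc p = a % suc p

isSquareMod : ℕ → ℕ → Bool
isSquareMod a p = any (λ x → ((x * x) mod p) ≡ᵇ (a mod p)) (upTo p)

legendre : ℕ → ℕ → ℤ
legendre a p =
  if does (p ∣? a) then + 0
  else (if isSquareMod a p then + 1 else -[1+ 0 ])

-- Jacobi symbol (a/n) = ∏ over the prime factorisation n = p₁⋯p_k
-- (with multiplicity) of the Legendre symbols (a/pᵢ).
-- (For n = 0 the value is irrelevant; we set it to 0.)
jacobi : ℕ → ℕ → ℤ
jacobi a zero = + 0
jacobi a (suc m) =
  foldr (λ p r → legendre a p ℤ.* r) (+ 1) (factors (factorise (suc m)))

sumBelow : ℕ → (ℕ → ℤ) → ℤ
sumBelow n f = foldr (λ x r → f x ℤ.+ r) (+ 0) (upTo n)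

IsSumOfTwoSquares : ℕ → Set
IsSumOfTwoSquares n = Σ ℤ λ a → Σ ℤ λ b → + n ≡ a ℤ.* a ℤ.+ b ℤ.* b
  where
  open import Data.Product using (Σ)
  open import Relation.Binary.PropositionalEquality using (_≡_)

{-# OPTIONS --safe #-}
-- For odd n the theorem follows from a stronger statement: the sum S(n) is
-- nonzero exactly when n is a sum of two squares. By the Chinese remainder
-- theorem S is multiplicative up to nonzero factors. For a prime p ≡ 3 (mod 4),
-- S(p) = 0 because x ↦ -x changes the sign of every term. For p ≡ 1 (mod 4) the
-- term is invariant under x ↦ -x and x ↦ x⁻¹, so that the orbit of ±1 gives
-- S(p) ≡ 2 (mod 4). A factor p² contributes a sum of squares, which is positive.
-- Thus S(n) = 0 exactly when some p ≡ 3 (mod 4) divides n to an odd power, and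
-- that is Fermat's criterion. The existence of √-1 modulo p ≡ 1 (mod 4) comes
-- from the same orbit count.
module Submission where

open import Defs

-- The obstacle in the orbit count is that x ↦ x⁻¹ need not respect a choice of one element from
-- each pair ±x, so halving the sum once per involution is not immediate. The half system is
-- therefore fixed in advance, and x⁻¹ is replaced by whichever of ±x⁻¹ lies in the same half as x;
-- this is again an involution, and two halvings give the factor 4.
--
-- Legendre symbols are compared through two laws only: scaling of the argument by the square of a
-- unit, and, for p ≡ 3 (mod 4), change of sign. For p ≡ 1 (mod 4) the sign is itself a square.
--
-- The criterion of Fermat appears without exponents. The induction strips p when p divides n
-- exactly once and p² otherwise, and each removal carries both properties, being a sum of two
-- squares and having a nonzero character sum, between n and the cofactor. Stripping p² splits
-- again: if p still divides the cofactor, the extra symbols are absorbed by l³ = l and the sum is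
-- merely multiplied by p²; if not, the squared symbols form a local factor of their own.

module _ where

  open import Data.Integer.Properties using (+-*-semiring; pos-*; +-identityˡ; +-identityʳ; *-zeroʳ; *-identityʳ; *-identityˡ; *-comm; *-assoc)
  open import Algebra.Properties.Semiring.Sum +-*-semiring
    using (sum; sum-syntax; sum-cong-≗; ∑-distrib-+; ∑-comm; sum-permute; sum-replicate-zero; *-distribˡ-sum; *-distribʳ-sum)
  import Data.Bool.Properties as Bool
  open import Data.Bool.Base using (Bool; true; false; not; if_then_else_; T)
  open import Data.Empty using (⊥)
  open import Data.Fin.Base as Fin using (Fin; zero; suc; toℕ; fromℕ<; combine; punchOut; _↑ˡ_; _↑ʳ_)
  open import Data.Fin.Permutation using (permutation)
  import Data.Fin.Properties as Fin
  open import Data.Fin.Properties using (injective⇒≤; any?; pigeonhole; punchOut-injective; toℕ-injective; toℕ<n; toℕ-fromℕ<; toℕ-combine)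
  import Data.Integer.Base as ℤ
  open import Data.Integer.Base using (ℤ; +_; -[1+_]; 0ℤ; 1ℤ; -1ℤ; _+_; _*_; _-_; -_; ∣_∣)
  import Data.Integer.Coprimality as ℤ using (coprime-divisor)
  open import Data.Integer.DivMod using (_%ℕ_; _/ℕ_; a≡a%ℕn+[a/ℕn]*n; n%ℕd<d)
  open import Data.Integer.Divisibility.Signed using (_∣_; divides; _∣?_; ∣ᵤ⇒∣; ∣⇒∣ᵤ; ∣-trans; ∣m⇒∣-m; ∣n⇒∣m*n; ∣m∣n⇒∣m+n)
  import Data.Integer.Properties as ℤ
  open import Data.Integer.Tactic.RingSolver using (solve-∀)
  open import Data.List.Base using (List; []; _∷_; foldr; upTo; applyUpTo)
  open import Data.List.Membership.Propositional using (lose)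
  open import Data.List.Membership.Propositional.Properties using (∈-upTo⁺)
  open import Data.List.Relation.Binary.Permutation.Propositional as ↭ using (_↭_)
  open import Data.List.Relation.Unary.All using (All; []; _∷_)
  import Data.List.Relation.Unary.Any as Any
  import Data.List.Relation.Unary.Any.Properties as Any
  import Data.Nat.Base as ℕ
  open import Data.Nat.Base using (ℕ; zero; suc; NonZero)
  open import Data.Nat.Coprimality using (Coprime)
  import Data.Nat.Divisibility as ℕ
  import Data.Nat.DivMod as ℕ
  open import Data.Nat.Induction using (<-rec)
  open import Data.Nat.ListAction using (product)
  open import Data.Nat.Primality using (Prime; euclidsLemma; prime⇒nonZero; prime⇒nonTrivial; prime⇒irreducible)
  open import Data.Nat.Primality.Factorisation using (PrimeFactorisation; factorise; factors; factorisationUnique)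
  import Data.Nat.Properties as ℕ
  open import Data.Product.Base using (∃; ∃₂; _×_; _,_; proj₁; proj₂)
  open import Data.Sum.Base using (_⊎_; inj₁; inj₂; [_,_]′)
  open import Function.Base using (_∘_; id; case_of_)
  open import Function.Bundles using (_⇔_; mk⇔)
  open import Function.Definitions using (Injective)
  open import Relation.Binary.Definitions using (tri<; tri≈; tri>)
  open import Relation.Binary.PropositionalEquality using (_≡_; _≢_; refl; sym; trans; cong; cong₂; subst; module ≡-Reasoning)
  open import Relation.Nullary using (¬_; Dec; yes; no; does; contradiction)
  open import Relation.Nullary.Decidable using (map′; dec-true; dec-false; from-yes; from-no; ¬?; decidable-stable)

  -- Finite sums

  sumBelow≡∑ : ∀ n f → sumBelow n f ≡ ∑[ i < n ] f (toℕ i)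
  sumBelow≡∑ n f = go n id
    where
    go : ∀ n (h : ℕ → ℕ) → foldr (λ x r → f x + r) 0ℤ (applyUpTo h n) ≡ ∑[ i < n ] f (h (toℕ i))
    go zero    h = refl
    go (suc n) h = cong (λ z → f (h 0) + z) (go n (h ∘ suc))

  ∑-combine : ∀ m n (t : Fin (m ℕ.* n) → ℤ) →
              sum t ≡ ∑[ i < m ] ∑[ j < n ] t (combine i j)
  ∑-combine zero    n t = refl
  ∑-combine (suc m) n t = trans (∑-++ n (m ℕ.* n) t) (cong (λ z → ∑[ j < n ] t (j ↑ˡ m ℕ.* n) + z) (∑-combine m n (t ∘ (n ↑ʳ_))))
    where
    ∑-++ : ∀ a b (t : Fin (a ℕ.+ b) → ℤ) → sum t ≡ ∑[ i < a ] t (i ↑ˡ b) + ∑[ j < b ] t (a ↑ʳ j)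
    ∑-++ zero    b t = sym (+-identityˡ _)
    ∑-++ (suc a) b t = trans (cong (λ z → t zero + z) (∑-++ a b (t ∘ suc))) (sym (ℤ.+-assoc (t zero) _ _))

  ∑-zero : ∀ {n} {t : Fin n → ℤ} → (∀ i → t i ≡ 0ℤ) → sum t ≡ 0ℤ
  ∑-zero {n} t≗0 = trans (sum-cong-≗ t≗0) (sum-replicate-zero n)

  δ : ∀ {n} → Fin n → Fin n → ℤ
  δ a x = if does (x Fin.≟ a) then 1ℤ else 0ℤ

  δ-≡ : ∀ {n} {a x : Fin n} → x ≡ a → δ a x ≡ 1ℤ
  δ-≡ {a = a} {x} x≡a = cong (if_then 1ℤ else 0ℤ) (dec-true (x Fin.≟ a) x≡a)

  δ-≢ : ∀ {n} {a x : Fin n} → x ≢ a → δ a x ≡ 0ℤ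
  δ-≢ {a = a} {x} x≢a = cong (if_then 1ℤ else 0ℤ) (dec-false (x Fin.≟ a) x≢a)

  ∑-δ : ∀ {n} (a : Fin n) → sum (δ a) ≡ 1ℤ
  ∑-δ {suc n} zero    = cong₂ _+_ (δ-≡ {suc n} {zero} {zero} refl) (∑-zero {n} λ i → δ-≢ {a = zero} {suc i} λ ())
  ∑-δ {suc n} (suc a) = trans (cong₂ _+_ (δ-≢ {a = suc a} {zero} λ ()) (sum-cong-≗ shift)) (trans (+-identityˡ _) (∑-δ a))
    where
    shift : ∀ x → δ (suc a) (suc x) ≡ δ a x
    shift x with x Fin.≟ a
    ... | yes _ = refl
    ... | no  _ = refl

  -- If y were missed, punching it out of the codomain would inject `Fin (suc n)` into `Fin n`.
  injective⇒surjective : ∀ {n} {σ : Fin n → Fin n} → Injective _≡_ _≡_ σ → ∀ y → ∃ λ x → σ x ≡ y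
  injective⇒surjective {suc n} {σ} σ-inj y with any? (λ x → σ x Fin.≟ y)
  ... | yes hit = hit
  ... | no miss = contradiction (injective⇒≤ punched-injective) ℕ.1+n≰n
    where
    y≢σ : ∀ x → y ≢ σ x
    y≢σ x y≡σx = miss (x , sym y≡σx)
    punched : Fin (suc n) → Fin n
    punched x = punchOut (y≢σ x)
    punched-injective : Injective _≡_ _≡_ punched
    punched-injective eq = σ-inj (punchOut-injective (y≢σ _) (y≢σ _) eq)

  ∑-reindex : ∀ {n} {σ : Fin n → Fin n} → Injective _≡_ _≡_ σ → ∀ (t : Fin n → ℤ) →
              ∑[ i < n ] t (σ i) ≡ sum t
  ∑-reindex {n} {σ} σ-inj t = sym (sum-permute t π)
    where
    σ⁻¹ : Fin n → Fin n
    σ⁻¹ y = proj₁ (injective⇒surjective σ-inj y)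
    σσ⁻¹ : ∀ y → σ (σ⁻¹ y) ≡ y
    σσ⁻¹ y = proj₂ (injective⇒surjective σ-inj y)
    π = permutation σ σ⁻¹ σσ⁻¹ λ x → σ-inj (σσ⁻¹ (σ x))

  involutive⇒injective : ∀ {A : Set} {σ : A → A} → (∀ x → σ (σ x) ≡ x) → Injective _≡_ _≡_ σ
  involutive⇒injective {σ = σ} σσ {x} {y} eq = trans (sym (σσ x)) (trans (cong σ eq) (σσ y))

  -- Keeps one element of each two-element orbit of an involution σ.
  lower : ∀ {n} → (Fin n → Fin n) → (Fin n → ℤ) → Fin n → ℤ
  lower σ t x = if does (x Fin.<? σ x) then t x else 0ℤ

  -- A two-element orbit contributes the same value twice and is represented once, by its smaller
  -- element; fixed points contribute nothing by the last hypothesis.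
  ∑-involution : ∀ {n} {σ : Fin n → Fin n} (t : Fin n → ℤ) → (∀ x → σ (σ x) ≡ x) →
                 (∀ x → t (σ x) ≡ t x) → (∀ x → σ x ≡ x → t x ≡ 0ℤ) →
                 sum t ≡ + 2 * sum (lower σ t)
  ∑-involution {n} {σ} t σσ tσ fixed = begin
    sum t                                   ≡⟨ sum-cong-≗ split ⟩
    ∑[ x < n ] (lower σ t x + lower σ t (σ x)) ≡⟨ ∑-distrib-+ (lower σ t) (lower σ t ∘ σ) ⟩
    sum (lower σ t) + ∑[ x < n ] lower σ t (σ x) ≡⟨ cong (λ z → sum (lower σ t) + z) (∑-reindex (involutive⇒injective {σ = σ} σσ) (lower σ t)) ⟩
    sum (lower σ t) + sum (lower σ t)       ≡⟨ double _ ⟩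
    + 2 * sum (lower σ t)                   ∎
    where
    open ≡-Reasoning
    double : ∀ a → a + a ≡ + 2 * a
    double = solve-∀
    split : ∀ x → t x ≡ lower σ t x + lower σ t (σ x)
    split x with Fin.<-cmp x (σ x)
    ... | tri< x<σx _ σx≮x = sym (trans
            (cong₂ _+_ (cong (if_then t x else 0ℤ) (dec-true (x Fin.<? σ x) x<σx))
                       (cong (if_then t (σ x) else 0ℤ) (dec-false (σ x Fin.<? σ (σ x)) (subst (λ z → ¬ (σ x Fin.< z)) (sym (σσ x)) σx≮x))))
            (+-identityʳ (t x)))
    ... | tri> x≮σx _ σx<x = sym (trans
            (cong₂ _+_ (cong (if_then t x else 0ℤ) (dec-false (x Fin.<? σ x) x≮σx))
                       (cong (if_then t (σ x) else 0ℤ) (dec-true (σ x Fin.<? σ (σ x)) (subst (σ x Fin.<_) (sym (σσ x)) σx<x))))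
            (trans (+-identityˡ _) (tσ x)))
    ... | tri≈ x≮σx x≡σx σx≮x = trans (fixed x (sym x≡σx)) (sym
            (cong₂ _+_ (cong (if_then t x else 0ℤ) (dec-false (x Fin.<? σ x) x≮σx))
                       (cong (if_then t (σ x) else 0ℤ) (dec-false (σ x Fin.<? σ (σ x)) (subst (λ z → ¬ (σ x Fin.< z)) (sym (σσ x)) σx≮x)))))

  -- Congruences

  infix 4 _≈_[mod_]

  -- A record rather than a synonym, so that unification can recover x and y, which the difference x
  -- - y would hide.
  record _≈_[mod_] (x y : ℤ) (n : ℕ) : Set where
    constructor congruent
    field n∣x-y : + n ∣ x - y

  open _≈_[mod_]

  module Modular (n : ℕ) .{{n≢0 : NonZero n}} where

    infix 4 _≈_ _≈?_

    _≈_ : ℤ → ℤ → Set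
    x ≈ y = x ≈ y [mod n ]

    ≈-witness : ∀ {x y} k → x ≡ y + k * + n → x ≈ y
    ≈-witness {x} {y} k refl = congruent (divides k (cancel y (k * + n)))
      where
      cancel : ∀ y z → y + z - y ≡ z
      cancel = solve-∀

    ≈-reflexive : ∀ {x y} → x ≡ y → x ≈ y
    ≈-reflexive {x} refl = ≈-witness 0ℤ (sym (ℤ.+-identityʳ x))

    ≈-refl : ∀ {x} → x ≈ x
    ≈-refl = ≈-reflexive refl

    ≈-sym : ∀ {x y} → x ≈ y → y ≈ x
    ≈-sym {x} {y} (congruent n∣x-y) = congruent (subst (+ n ∣_) (flip x y) (∣m⇒∣-m n∣x-y))
      where
      flip : ∀ x y → - (x - y) ≡ y - x
      flip = solve-∀

    ≈-trans : ∀ {x y z} → x ≈ y → y ≈ z → x ≈ z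
    ≈-trans {x} {y} {z} (congruent a) (congruent b) = congruent (subst (+ n ∣_) (telescope x y z) (∣m∣n⇒∣m+n a b))
      where
      telescope : ∀ x y z → (x - y) + (y - z) ≡ x - z
      telescope = solve-∀

    +-cong : ∀ {x y u v} → x ≈ y → u ≈ v → x + u ≈ y + v
    +-cong {x} {y} {u} {v} (congruent a) (congruent b) = congruent (subst (+ n ∣_) (regroup x y u v) (∣m∣n⇒∣m+n a b))
      where
      regroup : ∀ x y u v → (x - y) + (u - v) ≡ (x + u) - (y + v)
      regroup = solve-∀

    neg-cong : ∀ {x y} → x ≈ y → - x ≈ - y
    neg-cong {x} {y} (congruent a) = congruent (subst (+ n ∣_) (regroup x y) (∣m⇒∣-m a))
      where
      regroup : ∀ x y → - (x - y) ≡ - x - - y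
      regroup = solve-∀

    *-cong : ∀ {x y u v} → x ≈ y → u ≈ v → x * u ≈ y * v
    *-cong {x} {y} {u} {v} (congruent a) (congruent b) =
      congruent (subst (+ n ∣_) (regroup x y u v) (∣m∣n⇒∣m+n (∣n⇒∣m*n u a) (∣n⇒∣m*n y b)))
      where
      regroup : ∀ x y u v → u * (x - y) + y * (u - v) ≡ x * u - y * v
      regroup = solve-∀

    *-congˡ : ∀ z {x y} → x ≈ y → z * x ≈ z * y
    *-congˡ z = *-cong (≈-refl {z})

    _≈?_ : ∀ x y → Dec (x ≈ y)
    x ≈? y = map′ congruent n∣x-y (+ n ∣? x - y)

    ≈0⇒∣ : ∀ {x} → x ≈ 0ℤ → + n ∣ x
    ≈0⇒∣ {x} (congruent d) = subst (+ n ∣_) (ℤ.+-identityʳ x) d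

    ∣⇒≈0 : ∀ {x} → + n ∣ x → x ≈ 0ℤ
    ∣⇒≈0 {x} d = congruent (subst (+ n ∣_) (sym (ℤ.+-identityʳ x)) d)

    -≈0⇒≈ : ∀ {x y} → x - y ≈ 0ℤ → x ≈ y
    -≈0⇒≈ d = congruent (≈0⇒∣ d)

    ≈⇒-≈0 : ∀ {x y} → x ≈ y → x - y ≈ 0ℤ
    ≈⇒-≈0 (congruent d) = ∣⇒≈0 d

    +≈0⇒≈- : ∀ {x y} → x + y ≈ 0ℤ → x ≈ - y
    +≈0⇒≈- {x} {y} e = -≈0⇒≈ (≈-trans (≈-reflexive (cong (λ z → x + z) (ℤ.neg-involutive y))) e)

    small-multiple : ∀ {x} → x ≈ 0ℤ → ∣ x ∣ ℕ.< n → x ≡ 0ℤ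
    small-multiple {x} x≈0 x<n with ∣ x ∣ in eq
    ... | zero  = ℤ.∣i∣≡0⇒i≡0 eq
    ... | suc k = contradiction (subst (n ℕ.∣_) eq (∣⇒∣ᵤ (≈0⇒∣ x≈0))) (ℕ.>⇒∤ x<n)

    residue-unique : ∀ {a b} → a ℕ.< n → b ℕ.< n → + a ≈ + b → a ≡ b
    residue-unique {a} {b} a<n b<n a≈b = ℤ.+-injective (ℤ.i-j≡0⇒i≡j (+ a) (+ b)
      (small-multiple (≈⇒-≈0 a≈b) (ℕ.≤-<-trans
        (subst (λ z → ∣ z ∣ ℕ.≤ a ℕ.⊔ b) (sym (ℤ.[+m]-[+n]≡m⊖n a b)) (ℤ.∣m⊝n∣≤m⊔n a b))
        (ℕ.⊔-lub a<n b<n))))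

    val : Fin n → ℤ
    val x = + toℕ x

    red : ℤ → Fin n
    red z = fromℕ< (n%ℕd<d z n)

    val-red : ∀ z → val (red z) ≈ z
    val-red z = ≈-sym (≈-witness (z /ℕ n) (trans (a≡a%ℕn+[a/ℕn]*n z n)
      (cong (λ r → + r + (z /ℕ n) * + n) (sym (toℕ-fromℕ< (n%ℕd<d z n))))))

    val-injective : ∀ {x y} → val x ≈ val y → x ≡ y
    val-injective {x} {y} e = toℕ-injective (residue-unique (toℕ<n x) (toℕ<n y) e)

    red-≈ : ∀ {z x} → z ≈ val x → red z ≡ x
    red-≈ {z} e = val-injective (≈-trans (val-red z) e)

    %-≈ : ∀ a → + (a ℕ.% n) ≈ + a
    %-≈ a = ≈-sym (≈-witness (+ (a ℕ./ n)) (trans (cong +_ (ℕ.m≡m%n+[m/n]*n a n))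
      (cong (λ z → + (a ℕ.% n) + z) (pos-* (a ℕ./ n) n))))

    %≡⇒≈ : ∀ a b → a ℕ.% n ≡ b ℕ.% n → + a ≈ + b
    %≡⇒≈ a b e = ≈-trans (≈-sym (%-≈ a)) (≈-trans (≈-reflexive (cong +_ e)) (%-≈ b))

    ≈⇒%≡ : ∀ a b → + a ≈ + b → a ℕ.% n ≡ b ℕ.% n
    ≈⇒%≡ a b e = residue-unique (ℕ.m%n<n a n) (ℕ.m%n<n b n) (≈-trans (%-≈ a) (≈-trans e (≈-sym (%-≈ b))))

  -- Arithmetic modulo a prime

  module PrimeModulus {p : ℕ} (p-prime : Prime p) where

    instance
      p≢0 : NonZero p
      p≢0 = prime⇒nonZero p-prime

    open Modular p public

    euclid : ∀ {x y} → x * y ≈ 0ℤ → x ≈ 0ℤ ⊎ y ≈ 0ℤ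
    euclid {x} {y} xy≈0 with euclidsLemma ∣ x ∣ ∣ y ∣ p-prime (subst (p ℕ.∣_) (ℤ.abs-* x y) (∣⇒∣ᵤ (≈0⇒∣ xy≈0)))
    ... | inj₁ p∣x = inj₁ (∣⇒≈0 (∣ᵤ⇒∣ p∣x))
    ... | inj₂ p∣y = inj₂ (∣⇒≈0 (∣ᵤ⇒∣ p∣y))

    *-cancelˡ : ∀ {z x y} → ¬ z ≈ 0ℤ → z * x ≈ z * y → x ≈ y
    *-cancelˡ {z} {x} {y} z≉0 e =
      [ (λ z≈0 → contradiction z≈0 z≉0) , -≈0⇒≈ ]′
        (euclid {z} {x - y} (≈-trans (≈-reflexive (distrib z x y)) (≈⇒-≈0 e)))
      where
      distrib : ∀ z x y → z * (x - y) ≡ z * x - z * y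
      distrib = solve-∀

    squares≈⇒≈± : ∀ {x y} → x * x ≈ y * y → x ≈ y ⊎ x ≈ - y
    squares≈⇒≈± {x} {y} e =
      [ inj₁ ∘ -≈0⇒≈ , inj₂ ∘ +≈0⇒≈- ]′
        (euclid {x - y} {x + y} (≈-trans (≈-reflexive (factor x y)) (≈⇒-≈0 e)))
      where
      factor : ∀ x y → (x - y) * (x + y) ≡ x * x - y * y
      factor = solve-∀

    square≈0 : ∀ {x} → x * x ≈ 0ℤ → x ≈ 0ℤ
    square≈0 e = [ id , id ]′ (euclid e)

    1≉0 : ¬ 1ℤ ≈ 0ℤ
    1≉0 e with () ← small-multiple e (ℕ.nonTrivial⇒n>1 p {{prime⇒nonTrivial p-prime}})

    -- Multiplication by z is injective on the finite set of residues, hence hits 1.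
    inverse : ∀ {z} → ¬ z ≈ 0ℤ → ∃ λ w → z * w ≈ 1ℤ
    inverse {z} z≉0 = let w , zw≡1 = injective⇒surjective scale-injective (red 1ℤ)
                      in val w , ≈-trans (≈-sym (val-red (z * val w))) (≈-trans (≈-reflexive (cong val zw≡1)) (val-red 1ℤ))
      where
      scale : Fin p → Fin p
      scale x = red (z * val x)
      scale-injective : Injective _≡_ _≡_ scale
      scale-injective {x} {y} e = val-injective (*-cancelˡ z≉0
        (≈-trans (≈-sym (val-red (z * val x))) (≈-trans (≈-reflexive (cong val e)) (val-red (z * val y)))))

    unit≉0 : ∀ {x y} → x * y ≈ 1ℤ → ¬ x ≈ 0ℤ
    unit≉0 {x} {y} xy≈1 x≈0 = 1≉0 (≈-trans (≈-sym xy≈1) (*-cong x≈0 (≈-refl {y})))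

  -- Sums over residues modulo an odd prime

  module OddPrimeModulus {p : ℕ} (p-prime : Prime p) (2≉0 : ¬ + 2 ≈ 0ℤ [mod p ]) where

    open PrimeModulus p-prime public

    1≉-1 : ¬ 1ℤ ≈ -1ℤ
    1≉-1 1≈-1 = 2≉0 (≈⇒-≈0 1≈-1)

    neg : Fin p → Fin p
    neg x = red (- val x)

    neg-involutive : ∀ x → neg (neg x) ≡ x
    neg-involutive x = red-≈ (≈-trans (neg-cong (val-red (- val x))) (≈-reflexive (ℤ.neg-involutive (val x))))

    neg-fixed : ∀ {x} → neg x ≡ x → val x ≈ 0ℤ
    neg-fixed {x} e = [ (λ 2≈0 → contradiction 2≈0 2≉0) , id ]′
      (euclid {+ 2} {val x} (≈-trans (≈-reflexive (double (val x)))
        (≈⇒-≈0 {val x} (≈-trans (≈-reflexive (cong val (sym e))) (val-red (- val x))))))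
      where
      double : ∀ a → + 2 * a ≡ a - - a
      double = solve-∀

    -- A half system: it contains exactly one of ±x for x ≠ 0, and omits 0. The test is literally
    -- the one inside `lower neg`, so invariance of the half transfers directly to the halved sum.
    inLowerHalf : Fin p → Bool
    inLowerHalf x = does (x Fin.<? neg x)

    inLowerHalf-neg : ∀ {x} → ¬ val x ≈ 0ℤ → inLowerHalf (neg x) ≡ not (inLowerHalf x)
    inLowerHalf-neg {x} x≉0 = subst (λ y → does (neg x Fin.<? y) ≡ not (inLowerHalf x)) (sym (neg-involutive x)) (swap (Fin.<-cmp x (neg x)))
      where
      swap : _ → does (neg x Fin.<? x) ≡ not (does (x Fin.<? neg x))
      swap (tri< x<-x _ -x≮x) = trans (dec-false (neg x Fin.<? x) -x≮x) (cong not (sym (dec-true (x Fin.<? neg x) x<-x)))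
      swap (tri≈ _ x≡-x _)    = contradiction (neg-fixed (sym x≡-x)) x≉0
      swap (tri> x≮-x _ -x<x) = trans (dec-true (neg x Fin.<? x) -x<x) (cong not (sym (dec-false (x Fin.<? neg x) x≮-x)))

    inLowerHalf-unique : ∀ {x y} → val x ≈ val y ⊎ val x ≈ - val y → inLowerHalf x ≡ inLowerHalf y → x ≡ y
    inLowerHalf-unique (inj₁ x≈y) _ = val-injective x≈y
    inLowerHalf-unique {x} {y} (inj₂ x≈-y) same = go (val y ≈? 0ℤ)
      where
      go : Dec (val y ≈ 0ℤ) → x ≡ y
      go (yes y≈0) = val-injective (≈-trans x≈-y (≈-trans (neg-cong y≈0) (≈-sym y≈0)))
      go (no  y≉0) = contradiction (trans (sym (cong inLowerHalf (red-≈ (≈-sym x≈-y)))) (inLowerHalf-neg y≉0))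
        (Bool.not-¬ same)

    -- Exactly one of ±x⁻¹ lies in the same half as x, so Reciprocal is the graph
    -- of an involution that preserves the lower half.
    Reciprocal : Fin p → Fin p → Set
    Reciprocal x y = inLowerHalf x ≡ inLowerHalf y ×
      -- The square says xy ≈ ±1 without naming the sign; 0 is paired with itself.
      ((val x ≈ 0ℤ × val y ≈ 0ℤ) ⊎ (val x * val y) * (val x * val y) ≈ 1ℤ)

    Reciprocal-sym : ∀ {x y} → Reciprocal x y → Reciprocal y x
    Reciprocal-sym (same , inj₁ (x≈0 , y≈0)) = sym same , inj₁ (y≈0 , x≈0)
    Reciprocal-sym {x} {y} (same , inj₂ e) = sym same , inj₂ (≈-trans (≈-reflexive (cong (λ z → z * z) (*-comm (val y) (val x)))) e)

    Reciprocal-unique : ∀ {x y z} → Reciprocal x y → Reciprocal x z → y ≡ z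
    Reciprocal-unique (_ , inj₁ (_ , y≈0)) (_ , inj₁ (_ , z≈0)) = val-injective (≈-trans y≈0 (≈-sym z≈0))
    Reciprocal-unique {x} {y} {z} (_ , inj₁ (x≈0 , _)) (_ , inj₂ e) =
      contradiction (≈-trans (≈-sym e) (*-cong (*-cong x≈0 (≈-refl {val z})) (≈-refl {val x * val z}))) 1≉0
    Reciprocal-unique {x} {y} {z} (_ , inj₂ e) (_ , inj₁ (x≈0 , _)) =
      contradiction (≈-trans (≈-sym e) (*-cong (*-cong x≈0 (≈-refl {val y})) (≈-refl {val x * val y}))) 1≉0
    Reciprocal-unique {x} {y} {z} (x~y , inj₂ e) (x~z , inj₂ f) =
      inLowerHalf-unique ±[y≈z] (trans (sym x~y) x~z)
      where
      x≉0 : ¬ val x ≈ 0ℤ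
      x≉0 x≈0 = 1≉0 (≈-trans (≈-sym e) (*-cong (*-cong x≈0 (≈-refl {val y})) (≈-refl {val x * val y})))
      pull : ∀ a b → - (a * b) ≡ a * - b
      pull = solve-∀
      ±[y≈z] : val y ≈ val z ⊎ val y ≈ - val z
      ±[y≈z] = [ inj₁ ∘ *-cancelˡ x≉0 , (λ e → inj₂ (*-cancelˡ x≉0 (≈-trans e (≈-reflexive (pull (val x) (val z)))))) ]′
        (squares≈⇒≈± (≈-trans e (≈-sym f)))

    reciprocal : ∀ x → ∃ (Reciprocal x)
    reciprocal x = go (val x ≈? 0ℤ)
      where
      go : Dec (val x ≈ 0ℤ) → ∃ (Reciprocal x)
      go (yes x≈0) = x , refl , inj₁ (x≈0 , x≈0)
      go (no  x≉0) = choose (inLowerHalf x Bool.≟ inLowerHalf (red w))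
        where
        w = proj₁ (inverse x≉0)
        xw≈1 : val x * val (red w) ≈ 1ℤ
        xw≈1 = ≈-trans (*-congˡ (val x) (val-red w)) (proj₂ (inverse x≉0))
        w≉0 : ¬ val (red w) ≈ 0ℤ
        w≉0 = unit≉0 (≈-trans (≈-reflexive (*-comm (val (red w)) (val x))) xw≈1)
        negate : ∀ a b → a * - b ≡ - (a * b)
        negate = solve-∀
        x[-w]≈-1 : val x * val (neg (red w)) ≈ -1ℤ
        x[-w]≈-1 = ≈-trans (*-congˡ (val x) (val-red (- val (red w))))
          (≈-trans (≈-reflexive (negate (val x) (val (red w)))) (neg-cong xw≈1))
        choose : Dec (inLowerHalf x ≡ inLowerHalf (red w)) → ∃ (Reciprocal x)
        choose (yes same) = red w , same , inj₂ (*-cong xw≈1 xw≈1)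
        choose (no  diff) = neg (red w) , trans (Bool.¬-not diff) (sym (inLowerHalf-neg w≉0)) , inj₂ (*-cong x[-w]≈-1 x[-w]≈-1)

    recip : Fin p → Fin p
    recip x = proj₁ (reciprocal x)

    recip-involutive : ∀ x → recip (recip x) ≡ x
    recip-involutive x = Reciprocal-unique {recip x} (proj₂ (reciprocal (recip x))) (Reciprocal-sym {x} (proj₂ (reciprocal x)))

    -- The maps x ↦ -x and x ↦ x⁻¹ generate a Klein four-group acting on the
    -- residues; its only orbits of size less than four are {0}, {±1} and {±√-1}.
    ∑-mod-4 : ∀ (g : Fin p → ℤ) →
              (∀ {x} → val x ≈ 0ℤ → g x ≡ 0ℤ) →
              (∀ {x y} → val x ≈ - val y → g x ≡ g y) →
              (∀ {x y} → val x * val y ≈ 1ℤ → g x ≡ g y) →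
              (∀ {x} → val x * val x ≈ -1ℤ → g x ≡ 0ℤ) →
              ∃ λ k → sum g ≡ + 4 * k + + 2 * g (red 1ℤ)
    -- The witness sums g over one representative of each four-element orbit: `w` keeps one of ±x,
    -- and `lower recip` keeps one of the two pairs ±x, ±x⁻¹.
    ∑-mod-4 g g-zero g-neg g-inv g-√-1 = sum (lower recip w) , (begin
      sum g                                                    ≡⟨ sum-cong-≗ split ⟩
      ∑[ x < p ] (g′ x + g one * (δ one x + δ minusOne x))     ≡⟨ ∑-distrib-+ g′ (λ x → g one * (δ one x + δ minusOne x)) ⟩
      sum g′ + ∑[ x < p ] (g one * (δ one x + δ minusOne x))   ≡⟨ cong₂ _+_ ∑g′ (sym (*-distribˡ-sum (g one) (λ x → δ one x + δ minusOne x))) ⟩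
      + 2 * (+ 2 * sum (lower recip w)) + g one * ∑[ x < p ] (δ one x + δ minusOne x)
                                                               ≡⟨ cong (λ s → + 2 * (+ 2 * sum (lower recip w)) + g one * s) ∑δ≡2 ⟩
      + 2 * (+ 2 * sum (lower recip w)) + g one * + 2          ≡⟨ regroup (sum (lower recip w)) (g one) ⟩
      + 4 * sum (lower recip w) + + 2 * g one                  ∎)
      where
      open ≡-Reasoning
      one = red 1ℤ
      minusOne = neg one

      regroup : ∀ s c → + 2 * (+ 2 * s) + c * + 2 ≡ + 4 * s + + 2 * c
      regroup = solve-∀

      one≈1 : val one ≈ 1ℤ
      one≈1 = val-red 1ℤ
      minusOne≈-1 : val minusOne ≈ -1ℤ
      minusOne≈-1 = ≈-trans (val-red (- val one)) (neg-cong one≈1)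
      one≢minusOne : one ≢ minusOne
      one≢minusOne e = 1≉-1 (≈-trans (≈-sym one≈1) (≈-trans (≈-reflexive (cong val e)) minusOne≈-1))

      ∑δ≡2 : ∑[ x < p ] (δ one x + δ minusOne x) ≡ + 2
      ∑δ≡2 = trans (∑-distrib-+ (δ one) (δ minusOne)) (cong₂ _+_ (∑-δ one) (∑-δ minusOne))

      Root : Fin p → Set
      Root x = val x * val x ≈ 1ℤ
      root? : ∀ x → Dec (Root x)
      root? x = (val x * val x) ≈? 1ℤ

      -- Removing the values at ±1 makes the function vanish on every orbit with fewer than four
      -- elements, as both applications of `∑-involution` require. The removed values return as the
      -- term 2 g(1).
      g′ : Fin p → ℤ
      g′ x = if does (root? x) then 0ℤ else g x
      g′-root : ∀ {x} → Root x → g′ x ≡ 0ℤ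
      g′-root {x} r = cong (if_then 0ℤ else g x) (dec-true (root? x) r)
      g′-nonroot : ∀ {x} → ¬ Root x → g′ x ≡ g x
      g′-nonroot {x} ¬r = cong (if_then 0ℤ else g x) (dec-false (root? x) ¬r)
      g′-zero : ∀ {x} → g x ≡ 0ℤ → g′ x ≡ 0ℤ
      g′-zero {x} gx≡0 = go (root? x)
        where
        go : Dec (Root x) → g′ x ≡ 0ℤ
        go (yes r) = g′-root r
        go (no ¬r) = trans (g′-nonroot ¬r) gx≡0
      g′-cong : ∀ {x y} → (Root x → Root y) → (Root y → Root x) → g x ≡ g y → g′ x ≡ g′ y
      g′-cong {x} {y} to from gx≡gy = go (root? x)
        where
        go : Dec (Root x) → g′ x ≡ g′ y
        go (yes r) = trans (g′-root r) (sym (g′-root (to r)))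
        go (no ¬r) = trans (g′-nonroot ¬r) (trans gx≡gy (sym (g′-nonroot (¬r ∘ from))))
      g′-neg : ∀ {x y} → val x ≈ - val y → g′ x ≡ g′ y
      g′-neg {x} {y} x≈-y = g′-cong (≈-trans (≈-sym x²≈y²)) (≈-trans x²≈y²) (g-neg x≈-y)
        where
        square-neg : ∀ a → - a * - a ≡ a * a
        square-neg = solve-∀
        x²≈y² : val x * val x ≈ val y * val y
        x²≈y² = ≈-trans (*-cong x≈-y x≈-y) (≈-reflexive (square-neg (val y)))
      g′-inv : ∀ {x y} → val x * val y ≈ 1ℤ → g′ x ≡ g′ y
      g′-inv {x} {y} xy≈1 = g′-cong (root-inv {x} {y} xy≈1)
        (root-inv {y} {x} (≈-trans (≈-reflexive (*-comm (val y) (val x))) xy≈1)) (g-inv xy≈1)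
        where
        regroup′ : ∀ a b → b * b * (a * a) ≡ (a * b) * (a * b)
        regroup′ = solve-∀
        root-inv : ∀ {x y} → val x * val y ≈ 1ℤ → Root x → Root y
        root-inv {x} {y} e r = ≈-trans (≈-reflexive (sym (*-identityʳ (val y * val y))))
          (≈-trans (*-congˡ (val y * val y) (≈-sym r))
          (≈-trans (≈-reflexive (regroup′ (val x) (val y))) (*-cong e e)))

      split : ∀ x → g x ≡ g′ x + g one * (δ one x + δ minusOne x)
      split x = go (root? x)
        where
        at-root : ∀ c → 0ℤ + c * 1ℤ ≡ c
        at-root = solve-∀
        elsewhere : ∀ a c → a + c * 0ℤ ≡ a
        elsewhere = solve-∀
        go : Dec (Root x) → g x ≡ g′ x + g one * (δ one x + δ minusOne x)
        go (no ¬r) = sym (trans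
          (cong₂ (λ a d → a + g one * d) (g′-nonroot ¬r)
            (cong₂ _+_ (δ-≢ {x = x} (λ { refl → ¬r (*-cong one≈1 one≈1) }))
                       (δ-≢ {x = x} (λ { refl → ¬r (*-cong minusOne≈-1 minusOne≈-1) }))))
          (elsewhere (g x) (g one)))
        go (yes r) = [ at-one , at-minusOne ]′ (squares≈⇒≈± {val x} {1ℤ} r)
          where
          combine-δ : g x ≡ g one → δ one x + δ minusOne x ≡ 1ℤ → g x ≡ g′ x + g one * (δ one x + δ minusOne x)
          combine-δ gx e = trans gx (sym (trans (cong₂ (λ a d → a + g one * d) (g′-root r) e) (at-root (g one))))
          at-one : val x ≈ 1ℤ → _
          at-one x≈1 = combine-δ (cong g x≡1) (cong₂ _+_ (δ-≡ x≡1) (δ-≢ (λ e → one≢minusOne (trans (sym x≡1) e))))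
            where
            x≡1 : x ≡ one
            x≡1 = val-injective (≈-trans x≈1 (≈-sym one≈1))
          at-minusOne : val x ≈ -1ℤ → _
          at-minusOne x≈-1 = combine-δ (g-neg (≈-trans x≈-1 (neg-cong (≈-sym one≈1))))
            (cong₂ _+_ (δ-≢ (λ e → one≢minusOne (trans (sym e) x≡-1))) (δ-≡ x≡-1))
            where
            x≡-1 : x ≡ minusOne
            x≡-1 = val-injective (≈-trans x≈-1 (≈-sym minusOne≈-1))

      w : Fin p → ℤ
      w = lower neg g′

      w-zero : ∀ {x} → g′ x ≡ 0ℤ → w x ≡ 0ℤ
      w-zero {x} e with inLowerHalf x
      ... | true  = e
      ... | false = refl

      g′-recip : ∀ x → g′ (recip x) ≡ g′ x
      g′-recip x = go (proj₂ (proj₂ (reciprocal x)))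
        where
        go : _ → g′ (recip x) ≡ g′ x
        go (inj₁ (x≈0 , rx≈0)) = trans (g′-zero (g-zero rx≈0)) (sym (g′-zero (g-zero x≈0)))
        -- If x · `recip x` ≈ -1, then `recip x` is the inverse of -x, and evenness leads back to x.
        go (inj₂ e) = [ sym ∘ g′-inv , (λ e → trans (sym (g′-inv (via-neg e))) (g′-neg (val-red (- val x)))) ]′ (squares≈⇒≈± {val x * val (recip x)} {1ℤ} e)
          where
          negate : ∀ a b → - a * b ≡ - (a * b)
          negate = solve-∀
          via-neg : val x * val (recip x) ≈ -1ℤ → val (neg x) * val (recip x) ≈ 1ℤ
          via-neg e = ≈-trans (*-cong (val-red (- val x)) (≈-refl {val (recip x)}))
            (≈-trans (≈-reflexive (negate (val x) (val (recip x)))) (neg-cong e))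

      w-recip : ∀ x → w (recip x) ≡ w x
      w-recip x = cong₂ (if_then_else 0ℤ) (sym (proj₁ (proj₂ (reciprocal x)))) (g′-recip x)

      -- A fixed point has x ≈ 0, x² ≈ 1 or x² ≈ -1: the first and third are zeros of g by
      -- hypothesis, the second has been removed.
      recip-fixed : ∀ x → recip x ≡ x → w x ≡ 0ℤ
      recip-fixed x fixed = w-zero {x} (go (proj₂ (proj₂ (reciprocal x))))
        where
        x²≈ : ∀ {c} → val x * val (recip x) ≈ c → val x * val x ≈ c
        x²≈ = ≈-trans (≈-reflexive (cong (λ y → val x * val y) (sym fixed)))
        go : _ → g′ x ≡ 0ℤ
        go (inj₁ (x≈0 , _)) = g′-zero (g-zero x≈0)
        go (inj₂ e) = [ g′-root ∘ x²≈ , g′-zero ∘ g-√-1 ∘ x²≈ ]′ (squares≈⇒≈± {val x * val (recip x)} {1ℤ} e)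

      ∑g′ : sum g′ ≡ + 2 * (+ 2 * sum (lower recip w))
      ∑g′ = trans (∑-involution g′ neg-involutive (λ x → g′-neg (val-red (- val x))) (λ x → g′-zero ∘ g-zero ∘ neg-fixed))
        (cong (+ 2 *_) (∑-involution w recip-involutive w-recip recip-fixed))

  -- Square roots of -1

  module Mod4 = Modular 4

  sumOfTwoSquares⇒≢3[mod4] : ∀ {n a b} → + n ≡ a * a + b * b → n ℕ.% 4 ≢ 3
  sumOfTwoSquares⇒≢3[mod4] {n} {a} {b} n≡a²+b² n%4≡3 =
    table (red a) (red b) (≈-trans
      (+-cong (*-cong (val-red a) (val-red a)) (*-cong (val-red b) (val-red b)))
      (≈-trans (≈-reflexive (sym n≡a²+b²)) (%≡⇒≈ n 3 n%4≡3)))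
    where
    open Mod4
    table : ∀ (i j : Fin 4) → ¬ val i * val i + val j * val j ≈ + 3
    table = from-yes (Fin.all? λ i → Fin.all? λ j → ¬? (val i * val i + val j * val j ≈? + 3))

  ∣i∣*∣i∣≡i*i : ∀ i → + (∣ i ∣ ℕ.* ∣ i ∣) ≡ i * i
  ∣i∣*∣i∣≡i*i (+ n)    = pos-* n n
  ∣i∣*∣i∣≡i*i -[1+ n ] = refl

  floor-sqrt : ∀ n → ∃ λ r → r ℕ.* r ℕ.≤ n × n ℕ.< suc r ℕ.* suc r
  floor-sqrt zero = 0 , ℕ.z≤n , ℕ.s≤s ℕ.z≤n
  floor-sqrt (suc n) = let r , r²≤n , n<[1+r]² = floor-sqrt n in step r r²≤n n<[1+r]² (suc r ℕ.* suc r ℕ.≤? suc n)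
    where
    step : ∀ r → r ℕ.* r ℕ.≤ n → n ℕ.< suc r ℕ.* suc r → Dec (suc r ℕ.* suc r ℕ.≤ suc n) →
           ∃ λ r → r ℕ.* r ℕ.≤ suc n × suc n ℕ.< suc r ℕ.* suc r
    step r r²≤n n<[1+r]² (yes [1+r]²≤1+n) = suc r , [1+r]²≤1+n ,
      ℕ.≤-<-trans n<[1+r]² (ℕ.*-mono-< (ℕ.n<1+n (suc r)) (ℕ.n<1+n (suc r)))
    step r r²≤n n<[1+r]² (no [1+r]²≰1+n) = r , ℕ.m≤n⇒m≤1+n r²≤n , ℕ.≰⇒> [1+r]²≰1+n

  ∣toℕ-toℕ∣≤ : ∀ {r} (x y : Fin (suc r)) → ∣ + toℕ x - + toℕ y ∣ ℕ.≤ r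
  ∣toℕ-toℕ∣≤ {r} x y = subst (λ z → ∣ z ∣ ℕ.≤ r) (sym (ℤ.[+m]-[+n]≡m⊖n (toℕ x) (toℕ y)))
    (ℕ.≤-trans (ℤ.∣m⊝n∣≤m⊔n (toℕ x) (toℕ y)) (ℕ.⊔-lub (Fin.toℕ≤pred[n] x) (Fin.toℕ≤pred[n] y)))

  -- Sharpens the bound r² ≤ p of `floor-sqrt` to r² < p, which keeps a² + b² strictly below 2p in
  -- Thue's argument.
  prime-not-square : ∀ {p} → Prime p → ∀ r → r ℕ.* r ≢ p
  prime-not-square {p} p-prime r r²≡p = excluded (prime⇒irreducible p-prime (ℕ.divides r (sym r²≡p)))
    where
    p≢1 : p ≢ 1
    p≢1 = ℕ.nonTrivial⇒≢1 {{prime⇒nonTrivial p-prime}}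
    excluded : r ≡ 1 ⊎ r ≡ p → ⊥
    excluded (inj₁ refl) = p≢1 (sym r²≡p)
    excluded (inj₂ refl) = p≢1 (ℕ.*-cancelˡ-≡ p 1 p {{prime⇒nonZero p-prime}} (trans r²≡p (sym (ℕ.*-identityʳ p))))

  -- Thue's lemma: among the more than p pairs (u, v) with u, v ≤ √p, two give
  -- the same residue u - i v; their difference (a, b) has a² + b² ≡ 0 and
  -- 0 < a² + b² < 2 p.
  √-1⇒sumOfTwoSquares : ∀ {p} → Prime p → ∀ {i} → i * i ≈ -1ℤ [mod p ] → ∃₂ λ a b → + p ≡ a * a + b * b
  √-1⇒sumOfTwoSquares {p} p-prime {i} i²≈-1 = a , b , (begin
    + p                                        ≡⟨ cong +_ (exact (∣⇒∣ᵤ (≈0⇒∣ (≈-trans (≈-reflexive N≡a²+b²) a²+b²≈0)))) ⟩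
    + N                                        ≡⟨ N≡a²+b² ⟩
    a * a + b * b                              ∎)
    where
    open ≡-Reasoning
    open PrimeModulus p-prime
    r = proj₁ (floor-sqrt p)

    u v : Fin (suc r ℕ.* suc r) → Fin (suc r)
    u k = proj₁ (Fin.remQuot {suc r} (suc r) k)
    v k = proj₂ (Fin.remQuot {suc r} (suc r) k)
    form : Fin (suc r ℕ.* suc r) → ℤ
    form k = + toℕ (u k) - i * + toℕ (v k)
    collision = pigeonhole (proj₂ (proj₂ (floor-sqrt p))) (red ∘ form)
    j = proj₁ collision
    k = proj₁ (proj₂ collision)
    j<k = proj₁ (proj₂ (proj₂ collision))
    a = + toℕ (u j) - + toℕ (u k)
    b = + toℕ (v j) - + toℕ (v k)

    a≈ib : a ≈ i * b
    a≈ib = -≈0⇒≈ (≈-trans (≈-reflexive (regroup i (+ toℕ (u j)) (+ toℕ (u k)) (+ toℕ (v j)) (+ toℕ (v k))))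
      (≈⇒-≈0 (≈-trans (≈-sym (val-red (form j)))
        (≈-trans (≈-reflexive (cong val (proj₂ (proj₂ (proj₂ collision))))) (val-red (form k))))))
      where
      regroup : ∀ i u u′ v v′ → (u - u′) - i * (v - v′) ≡ (u - i * v) - (u′ - i * v′)
      regroup = solve-∀

    a²+b²≈0 : a * a + b * b ≈ 0ℤ
    a²+b²≈0 = ≈-trans (+-cong (*-cong a≈ib a≈ib) (≈-refl {b * b}))
      (≈-trans (≈-reflexive (regroup i b))
      (≈-trans (+-cong (*-cong i²≈-1 (≈-refl {b * b})) (≈-refl {b * b}))
      (≈-reflexive (cancel b))))
      where
      regroup : ∀ i b → (i * b) * (i * b) + b * b ≡ (i * i) * (b * b) + b * b
      regroup = solve-∀
      cancel : ∀ b → -1ℤ * (b * b) + b * b ≡ 0ℤ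
      cancel = solve-∀

    N = ∣ a ∣ ℕ.* ∣ a ∣ ℕ.+ ∣ b ∣ ℕ.* ∣ b ∣
    N≡a²+b² : + N ≡ a * a + b * b
    N≡a²+b² = cong₂ _+_ (∣i∣*∣i∣≡i*i a) (∣i∣*∣i∣≡i*i b)

    N<2p : N ℕ.< p ℕ.+ p
    N<2p = ℕ.+-mono-< (square<p a (∣toℕ-toℕ∣≤ (u j) (u k))) (square<p b (∣toℕ-toℕ∣≤ (v j) (v k)))
      where
      square<p : ∀ c → ∣ c ∣ ℕ.≤ r → ∣ c ∣ ℕ.* ∣ c ∣ ℕ.< p
      square<p c c≤r = ℕ.≤-<-trans (ℕ.*-mono-≤ c≤r c≤r)
        (ℕ.≤∧≢⇒< (proj₁ (proj₂ (floor-sqrt p))) (prime-not-square p-prime r))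

    zero-coordinate : ∀ {x y : Fin (suc r)} → ∣ + toℕ x - + toℕ y ∣ ℕ.* ∣ + toℕ x - + toℕ y ∣ ≡ 0 → x ≡ y
    zero-coordinate {x} {y} e = toℕ-injective (ℤ.+-injective (ℤ.i-j≡0⇒i≡j (+ toℕ x) (+ toℕ y)
      (ℤ.∣i∣≡0⇒i≡0 ([ id , id ]′ (ℕ.m*n≡0⇒m≡0∨n≡0 ∣ + toℕ x - + toℕ y ∣ e)))))

    N≢0 : N ≢ 0
    N≢0 N≡0 = Fin.<⇒≢ j<k (begin
      j                   ≡⟨ Fin.combine-remQuot {suc r} (suc r) j ⟨
      combine (u j) (v j) ≡⟨ cong₂ combine (zero-coordinate {u j} {u k} (ℕ.m+n≡0⇒m≡0 _ N≡0)) (zero-coordinate {v j} {v k} (ℕ.m+n≡0⇒n≡0 (∣ a ∣ ℕ.* ∣ a ∣) N≡0)) ⟩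
      combine (u k) (v k) ≡⟨ Fin.combine-remQuot {suc r} (suc r) k ⟩
      k                   ∎)

    exact : p ℕ.∣ N → p ≡ N
    exact (ℕ.divides zero N≡0)            = contradiction N≡0 N≢0
    exact (ℕ.divides (suc zero) N≡p)      = sym (trans N≡p (ℕ.*-identityˡ p))
    exact (ℕ.divides (suc (suc q)) N≡)    = contradiction
      (ℕ.≤-reflexive (trans (ℕ.+-assoc p p (q ℕ.* p)) (sym N≡)))
      (ℕ.<⇒≱ (ℕ.<-≤-trans N<2p (ℕ.m≤m+n (p ℕ.+ p) (q ℕ.* p))))

  odd⇒2≉0 : ∀ {p} → Prime p → p ≢ 2 → ¬ + 2 ≈ 0ℤ [mod p ]
  odd⇒2≉0 {p} p-prime p≢2 2≈0 = p≢2 (ℕ.≤-antisym (ℕ.∣⇒≤ (∣⇒∣ᵤ (≈0⇒∣ 2≈0))) (ℕ.nonTrivial⇒n>1 p {{prime⇒nonTrivial p-prime}}))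
    where open PrimeModulus p-prime

  -- A root of -1 would make p a sum of two squares by Thue's lemma, and such a sum is never 3
  -- modulo 4.
  p≡3⇒no-√-1 : ∀ {p} → Prime p → p ℕ.% 4 ≡ 3 → ∀ i → ¬ i * i ≈ -1ℤ [mod p ]
  p≡3⇒no-√-1 p-prime p%4≡3 i i²≈-1 =
    let a , b , p≡a²+b² = √-1⇒sumOfTwoSquares p-prime {i} i²≈-1 in sumOfTwoSquares⇒≢3[mod4] {a = a} {b} p≡a²+b² p%4≡3

  -- The orbit count is applied to the indicator of the nonzero residues. Without a root of -1 the
  -- condition at ±√-1 is vacuous, so p - 1 = 4k + 2 and p ≡ 3 (mod 4), a contradiction.
  p≡1⇒√-1 : ∀ {p} → Prime p → p ℕ.% 4 ≡ 1 → ∃ λ i → i * i ≈ -1ℤ [mod p ]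
  p≡1⇒√-1 {p} p-prime p%4≡1 = decide (any? λ x → (val x * val x) ≈? -1ℤ)
    where
    p≢2 : p ≢ 2
    p≢2 refl = case p%4≡1 of λ ()
    open OddPrimeModulus p-prime (odd⇒2≉0 p-prime p≢2)
    origin = red 0ℤ
    nonzero : Fin p → ℤ
    nonzero x = 1ℤ - δ origin x
    ≡origin : ∀ {x} → val x ≈ 0ℤ → x ≡ origin
    ≡origin x≈0 = sym (red-≈ (≈-sym x≈0))
    ≈0 : ∀ {x} → x ≡ origin → val x ≈ 0ℤ
    ≈0 refl = val-red 0ℤ
    vanish : ∀ {x} → val x ≈ 0ℤ → nonzero x ≡ 0ℤ
    vanish x≈0 = cong (λ d → 1ℤ - d) (δ-≡ (≡origin x≈0))
    unit : ∀ {x} → ¬ val x ≈ 0ℤ → nonzero x ≡ 1ℤ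
    unit x≉0 = cong (λ d → 1ℤ - d) (δ-≢ (x≉0 ∘ ≈0))
    nonzero-cong : ∀ {x y} → (val x ≈ 0ℤ → val y ≈ 0ℤ) → (val y ≈ 0ℤ → val x ≈ 0ℤ) → nonzero x ≡ nonzero y
    nonzero-cong {x} {y} to from = go (val x ≈? 0ℤ)
      where
      go : Dec (val x ≈ 0ℤ) → nonzero x ≡ nonzero y
      go (yes x≈0) = trans (vanish x≈0) (sym (vanish (to x≈0)))
      go (no x≉0)  = trans (unit x≉0) (sym (unit (x≉0 ∘ from)))

    ∑-ones : ∀ n → ∑[ x < n ] 1ℤ ≡ + n
    ∑-ones zero    = refl
    ∑-ones (suc n) = cong (λ z → 1ℤ + z) (∑-ones n)

    p≡1+∑ : + p ≡ 1ℤ + sum nonzero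
    p≡1+∑ = begin
      + p                                ≡⟨ ∑-ones p ⟨
      ∑[ x < p ] 1ℤ                      ≡⟨ sum-cong-≗ (λ x → restore (δ origin x)) ⟩
      ∑[ x < p ] (δ origin x + nonzero x) ≡⟨ ∑-distrib-+ (δ origin) nonzero ⟩
      sum (δ origin) + sum nonzero       ≡⟨ cong (λ z → z + sum nonzero) (∑-δ origin) ⟩
      1ℤ + sum nonzero                   ∎
      where
      open ≡-Reasoning
      restore : ∀ d → 1ℤ ≡ d + (1ℤ - d)
      restore = solve-∀

    decide : Dec (∃ λ x → val x * val x ≈ -1ℤ) → ∃ λ i → i * i ≈ -1ℤ
    decide (yes (x , x²≈-1)) = val x , x²≈-1
    decide (no none) = contradiction 3≈1 (from-no (Mod4._≈?_ (+ 3) 1ℤ))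
      where
      counted : ∃ λ k → sum nonzero ≡ + 4 * k + + 2 * nonzero (red 1ℤ)
      counted = ∑-mod-4 nonzero vanish
        (λ {x} {y} x≈-y → nonzero-cong (λ x≈0 → ≈-trans (≈-reflexive (sym (ℤ.neg-involutive (val y)))) (neg-cong (≈-trans (≈-sym x≈-y) x≈0))) (λ y≈0 → ≈-trans x≈-y (neg-cong y≈0)))
        (λ {x} {y} xy≈1 → nonzero-cong {x} {y} (λ x≈0 → contradiction x≈0 (unit≉0 {val x} {val y} xy≈1))
          (λ y≈0 → contradiction y≈0 (unit≉0 {val y} {val x} (≈-trans (≈-reflexive (*-comm (val y) (val x))) xy≈1))))
        (λ {x} x²≈-1 → contradiction (x , x²≈-1) none)
      k = proj₁ counted
      p≡3+k*4 : + p ≡ + 3 + k * + 4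
      p≡3+k*4 = trans p≡1+∑ (trans (cong (λ z → 1ℤ + z) (trans (proj₂ counted)
        (cong (λ z → + 4 * k + + 2 * z) (unit {red 1ℤ} λ e → 1≉0 (≈-trans (≈-sym (val-red 1ℤ)) e))))) (regroup k))
        where
        regroup : ∀ k → 1ℤ + (+ 4 * k + + 2 * 1ℤ) ≡ + 3 + k * + 4
        regroup = solve-∀
      3≈1 : + 3 ≈ 1ℤ [mod 4 ]
      3≈1 = Mod4.≈-trans (Mod4.≈-sym (Mod4.≈-witness k p≡3+k*4)) (Mod4.%≡⇒≈ p 1 p%4≡1)

  -- Sums of two squares

  sumOfTwoSquares-* : ∀ {m n} → IsSumOfTwoSquares m → IsSumOfTwoSquares n → IsSumOfTwoSquares (m ℕ.* n)
  sumOfTwoSquares-* {m} {n} (a , b , m≡) (c , d , n≡) = a * c - b * d , a * d + b * c ,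
    trans (pos-* m n) (trans (cong₂ _*_ m≡ n≡) (brahmagupta a b c d))
    where
    brahmagupta : ∀ a b c d → (a * a + b * b) * (c * c + d * d) ≡
                  (a * c - b * d) * (a * c - b * d) + (a * d + b * c) * (a * d + b * c)
    brahmagupta = solve-∀

  sumOfTwoSquares-square : ∀ k → IsSumOfTwoSquares (k ℕ.* k)
  sumOfTwoSquares-square k = + k , 0ℤ , trans (pos-* k k) (sym (ℤ.+-identityʳ (+ k * + k)))

  module _ {p} (p-prime : Prime p) where
    open PrimeModulus p-prime

    private
      instance
        +p≢0 : ℤ.NonZero (+ p)
        +p≢0 = ℤ.≢-nonZero λ e → ℕ.≢-nonZero⁻¹ p (ℤ.+-injective e)

    -- With p = c² + d² and pm = a² + b², p divides (ad - bc)(ad + bc) = a²(c² + d²) - c²(a² + b²),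
    -- hence one factor; replacing c by -c exchanges the two. Once p divides ad - bc, the identity
    -- (ac + bd)² + (ad - bc)² = p²m shows that p divides ac + bd too, and the two quotients
    -- represent m.
    sumOfTwoSquares-quotient : ∀ {m} → IsSumOfTwoSquares p → IsSumOfTwoSquares (p ℕ.* m) → IsSumOfTwoSquares m
    sumOfTwoSquares-quotient {m} (c , d , p≡) (a , b , pm≡) =
      [ quotient-along c p≡
      , (λ ad+bc≈0 → quotient-along (- c) (trans p≡ (cong (λ s → s + d * d) (square-neg c)))
          (≈-trans (≈-reflexive (flip a b c d)) ad+bc≈0))
      ]′ (euclid {a * d - b * c} {a * d + b * c} product≈0)
      where
      pm≡a²+b² : + p * + m ≡ a * a + b * b
      pm≡a²+b² = trans (sym (pos-* p m)) pm≡
      square-neg : ∀ c → c * c ≡ - c * - c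
      square-neg = solve-∀
      flip : ∀ a b c d → a * d - b * - c ≡ a * d + b * c
      flip = solve-∀

      product≈0 : (a * d - b * c) * (a * d + b * c) ≈ 0ℤ
      product≈0 = ∣⇒≈0 (divides (a * a - c * c * + m) (begin
        (a * d - b * c) * (a * d + b * c)                       ≡⟨ expand a b c d ⟩
        a * a * (c * c + d * d) - c * c * (a * a + b * b)       ≡⟨ cong₂ (λ s t → a * a * s - c * c * t) (sym p≡) (sym pm≡a²+b²) ⟩
        a * a * + p - c * c * (+ p * + m)                       ≡⟨ collect (a * a) (c * c) (+ p) (+ m) ⟩
        (a * a - c * c * + m) * + p                             ∎))
        where
        open ≡-Reasoning
        expand : ∀ a b c d → (a * d - b * c) * (a * d + b * c) ≡ a * a * (c * c + d * d) - c * c * (a * a + b * b)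
        expand = solve-∀
        collect : ∀ s t p m → s * p - t * (p * m) ≡ (s - t * m) * p
        collect = solve-∀

      quotient-along : ∀ c → + p ≡ c * c + d * d → a * d - b * c ≈ 0ℤ → IsSumOfTwoSquares m
      quotient-along c p≡ ad-bc≈0 = assemble (≈0⇒∣ ad-bc≈0)
        where
        open ≡-Reasoning
        assemble : + p ∣ a * d - b * c → IsSumOfTwoSquares m
        assemble (divides u ad-bc≡up) = conclude (≈0⇒∣ (square≈0 (∣⇒≈0 (divides ((+ m - u * u) * + p) [ac+bd]²))))
          where
          lagrange : ∀ a b c d → (a * c + b * d) * (a * c + b * d) ≡ (a * a + b * b) * (c * c + d * d) - (a * d - b * c) * (a * d - b * c)
          lagrange = solve-∀
          collect : ∀ p m u → p * m * p - u * p * (u * p) ≡ (m - u * u) * p * p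
          collect = solve-∀
          [ac+bd]² : (a * c + b * d) * (a * c + b * d) ≡ (+ m - u * u) * + p * + p
          [ac+bd]² = begin
            (a * c + b * d) * (a * c + b * d)                                             ≡⟨ lagrange a b c d ⟩
            (a * a + b * b) * (c * c + d * d) - (a * d - b * c) * (a * d - b * c)         ≡⟨ cong₂ (λ s t → s - t * t) (cong₂ _*_ (sym pm≡a²+b²) (sym p≡)) ad-bc≡up ⟩
            + p * + m * + p - u * + p * (u * + p)                                         ≡⟨ collect (+ p) (+ m) u ⟩
            (+ m - u * u) * + p * + p                                                     ∎
          conclude : + p ∣ a * c + b * d → IsSumOfTwoSquares m
          conclude (divides v ac+bd≡vp) = u , v , (begin
            + m                      ≡⟨ recover (+ m) (u * u) ⟩
            (+ m - u * u) + u * u    ≡⟨ cong (λ s → s + u * u) m-u²≡v² ⟩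
            v * v + u * u            ≡⟨ ℤ.+-comm (v * v) (u * u) ⟩
            u * u + v * v            ∎)
            where
            recover : ∀ m s → m ≡ (m - s) + s
            recover = solve-∀
            regroup : ∀ v p → (v * p) * (v * p) ≡ v * v * p * p
            regroup = solve-∀
            m-u²≡v² : + m - u * u ≡ v * v
            m-u²≡v² = ℤ.*-cancelʳ-≡ (+ m - u * u) (v * v) (+ p) (ℤ.*-cancelʳ-≡ _ _ (+ p)
              (trans (sym [ac+bd]²) (trans (cong₂ _*_ ac+bd≡vp ac+bd≡vp) (regroup v (+ p)))))

    -- If b were a unit, a/b would be a square root of -1.
    a²+b²≈0⇒b≈0 : (∀ i → ¬ i * i ≈ -1ℤ) → ∀ a b → a * a + b * b ≈ 0ℤ → b ≈ 0ℤ
    a²+b²≈0⇒b≈0 no-√-1 a b e = go (b ≈? 0ℤ)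
      where
      go : Dec (b ≈ 0ℤ) → b ≈ 0ℤ
      go (yes b≈0) = b≈0
      go (no b≉0) = contradiction
        (≈-trans (≈-reflexive (regroup a w))
        (≈-trans (*-cong (+≈0⇒≈- {a * a} {b * b} e) (≈-refl {w * w}))
        (≈-trans (≈-reflexive (negate b w)) (neg-cong (*-cong bw≈1 bw≈1)))))
        (no-√-1 (a * w))
        where
        w = proj₁ (inverse b≉0)
        bw≈1 = proj₂ (inverse b≉0)
        regroup : ∀ a w → (a * w) * (a * w) ≡ (a * a) * (w * w)
        regroup = solve-∀
        negate : ∀ b w → - (b * b) * (w * w) ≡ - ((b * w) * (b * w))
        negate = solve-∀

    -- p divides both a and b, so p² divides a² + b². The conclusion serves twice: to remove p², and
    -- to exclude a p that divides the number exactly once.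
    sumOfTwoSquares-descent : p ℕ.% 4 ≡ 3 → ∀ {m} → IsSumOfTwoSquares (p ℕ.* m) → ∃ λ k → m ≡ p ℕ.* k × IsSumOfTwoSquares k
    sumOfTwoSquares-descent p%4≡3 {m} (a , b , pm≡) =
      assemble (≈0⇒∣ (a²+b²≈0⇒b≈0 no-√-1 b a (≈-trans (≈-reflexive (ℤ.+-comm (b * b) (a * a))) a²+b²≈0)))
               (≈0⇒∣ (a²+b²≈0⇒b≈0 no-√-1 a b a²+b²≈0))
      where
      no-√-1 = p≡3⇒no-√-1 p-prime p%4≡3
      pm≡a²+b² : + m * + p ≡ a * a + b * b
      pm≡a²+b² = trans (*-comm (+ m) (+ p)) (trans (sym (pos-* p m)) pm≡)
      a²+b²≈0 : a * a + b * b ≈ 0ℤ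
      a²+b²≈0 = ∣⇒≈0 (divides (+ m) (sym pm≡a²+b²))
      assemble : + p ∣ a → + p ∣ b → ∃ λ k → m ≡ p ℕ.* k × IsSumOfTwoSquares k
      assemble (divides u a≡up) (divides v b≡vp) = k , ℤ.+-injective m≡pk , u , v , k≡u²+v²
        where
        k = ∣ u ∣ ℕ.* ∣ u ∣ ℕ.+ ∣ v ∣ ℕ.* ∣ v ∣
        k≡u²+v² : + k ≡ u * u + v * v
        k≡u²+v² = cong₂ _+_ (∣i∣*∣i∣≡i*i u) (∣i∣*∣i∣≡i*i v)
        collect : ∀ u v p → u * p * (u * p) + v * p * (v * p) ≡ p * (u * u + v * v) * p
        collect = solve-∀
        m≡pk : + m ≡ + (p ℕ.* k)
        m≡pk = ℤ.*-cancelʳ-≡ (+ m) (+ (p ℕ.* k)) (+ p) (begin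
          + m * + p                             ≡⟨ pm≡a²+b² ⟩
          a * a + b * b                         ≡⟨ cong₂ (λ s t → s * s + t * t) a≡up b≡vp ⟩
          u * + p * (u * + p) + v * + p * (v * + p) ≡⟨ collect u v (+ p) ⟩
          + p * (u * u + v * v) * + p           ≡⟨ cong (λ s → + p * s * + p) (sym k≡u²+v²) ⟩
          + p * + k * + p                       ≡⟨ cong (λ s → s * + p) (sym (pos-* p k)) ⟩
          + (p ℕ.* k) * + p                     ∎)
          where open ≡-Reasoning

  -- The Legendre symbol

  mod≡% : ∀ a n .{{_ : NonZero n}} → a mod n ≡ a ℕ.% n
  mod≡% a (suc n) = refl

  module LegendreSymbol {p} (p-prime : Prime p) where
    open PrimeModulus p-prime

    -- The three cases as a relation on integers, which admits negative arguments although
    -- `legendre` takes naturals. Equalities of symbols follow by carrying a case from one argument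
    -- to another and applying `LegendreSpec-unique`.
    data LegendreSpec (c : ℤ) : ℤ → Set where
      vanishing  : c ≈ 0ℤ → LegendreSpec c 0ℤ
      residue    : ¬ c ≈ 0ℤ → ∀ y → y * y ≈ c → LegendreSpec c 1ℤ
      nonresidue : ¬ c ≈ 0ℤ → (∀ y → ¬ y * y ≈ c) → LegendreSpec c -1ℤ

    private
      squaresTo : ℕ → ℕ → Bool
      squaresTo a x = (x ℕ.* x) mod p ℕ.≡ᵇ a mod p

    isSquareMod-sound : ∀ a → T (isSquareMod a p) → ∃ λ y → y * y ≈ + a
    isSquareMod-sound a t =
      let x , x²≡a = Any.satisfied (Any.any⁻ (squaresTo a) (upTo p) t)
      in + x , ≈-trans (≈-reflexive (sym (pos-* x x)))
           (%≡⇒≈ (x ℕ.* x) a (trans (sym (mod≡% (x ℕ.* x) p)) (trans (ℕ.≡ᵇ⇒≡ _ _ x²≡a) (mod≡% a p))))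

    isSquareMod-complete : ∀ a y → y * y ≈ + a → T (isSquareMod a p)
    isSquareMod-complete a y y²≈a = Any.any⁺ (squaresTo a) (lose (∈-upTo⁺ (toℕ<n (red y))) (ℕ.≡⇒≡ᵇ _ _
      (trans (mod≡% (x ℕ.* x) p) (trans (≈⇒%≡ (x ℕ.* x) a
        (≈-trans (≈-reflexive (pos-* x x)) (≈-trans (*-cong (val-red y) (val-red y)) y²≈a))) (sym (mod≡% a p))))))
      where
      x = toℕ (red y)

    legendre-spec : ∀ a → LegendreSpec (+ a) (legendre a p)
    legendre-spec a with p ℕ.∣? a
    ... | yes p∣a = vanishing (∣⇒≈0 (∣ᵤ⇒∣ p∣a))
    ... | no  p∤a with isSquareMod a p in eq
    ...   | true  = let y , y²≈a = isSquareMod-sound a (subst T (sym eq) _)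
                    in residue (λ a≈0 → p∤a (∣⇒∣ᵤ (≈0⇒∣ a≈0))) y y²≈a
    ...   | false = nonresidue (λ a≈0 → p∤a (∣⇒∣ᵤ (≈0⇒∣ a≈0))) (λ y y²≈a → subst T eq (isSquareMod-complete a y y²≈a))

    LegendreSpec-unique : ∀ {c s t} → LegendreSpec c s → LegendreSpec c t → s ≡ t
    LegendreSpec-unique (vanishing _)       (vanishing _)       = refl
    LegendreSpec-unique (vanishing c≈0)     (residue c≉0 _ _)   = contradiction c≈0 c≉0
    LegendreSpec-unique (vanishing c≈0)     (nonresidue c≉0 _)  = contradiction c≈0 c≉0
    LegendreSpec-unique (residue c≉0 _ _)   (vanishing c≈0)     = contradiction c≈0 c≉0
    LegendreSpec-unique (residue _ _ _)     (residue _ _ _)     = refl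
    LegendreSpec-unique (residue _ y y²≈c)  (nonresidue _ none) = contradiction y²≈c (none y)
    LegendreSpec-unique (nonresidue c≉0 _)  (vanishing c≈0)     = contradiction c≈0 c≉0
    LegendreSpec-unique (nonresidue _ none) (residue _ y y²≈c)  = contradiction y²≈c (none y)
    LegendreSpec-unique (nonresidue _ _)    (nonresidue _ _)    = refl

    LegendreSpec-scale : ∀ {c d} u → ¬ u ≈ 0ℤ → c ≈ u * u * d → ∀ {s} → LegendreSpec d s → LegendreSpec c s
    LegendreSpec-scale {c} {d} u u≉0 c≈u²d = λ where
        (vanishing d≈0)     → vanishing (≈-trans c≈u²d (≈-trans (*-congˡ (u * u) d≈0) (≈-reflexive (*-zeroʳ (u * u)))))
        (residue d≉0 y y²≈d) → residue (c≉0 d≉0) (u * y)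
          (≈-trans (≈-reflexive (square-* u y)) (≈-trans (*-congˡ (u * u) y²≈d) (≈-sym c≈u²d)))
        -- A root of c divided by u would be a root of d.
        (nonresidue d≉0 none) → nonresidue (c≉0 d≉0) λ y y²≈c → none (u⁻¹ * y)
          (≈-trans (≈-reflexive (square-* u⁻¹ y)) (≈-trans (*-congˡ (u⁻¹ * u⁻¹) (≈-trans y²≈c c≈u²d))
          (≈-trans (≈-reflexive (regroup u u⁻¹ d)) (≈-trans (*-cong (*-cong uu⁻¹≈1 uu⁻¹≈1) (≈-refl {d})) (≈-reflexive (*-identityˡ d))))))
      where
      u⁻¹ = proj₁ (inverse u≉0)
      uu⁻¹≈1 = proj₂ (inverse u≉0)
      square-* : ∀ u y → (u * y) * (u * y) ≡ (u * u) * (y * y)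
      square-* = solve-∀
      regroup : ∀ u v d → v * v * (u * u * d) ≡ (u * v) * (u * v) * d
      regroup = solve-∀
      c≉0 : ¬ d ≈ 0ℤ → ¬ c ≈ 0ℤ
      c≉0 d≉0 c≈0 = [ (u≉0 ∘ square≈0) , d≉0 ]′ (euclid {u * u} {d} (≈-trans (≈-sym c≈u²d) c≈0))

    legendre-scale : ∀ {a b} u → ¬ u ≈ 0ℤ → + a ≈ u * u * + b → legendre a p ≡ legendre b p
    legendre-scale {a} {b} u u≉0 e = LegendreSpec-unique (legendre-spec a) (LegendreSpec-scale u u≉0 e (legendre-spec b))

    legendre-cong : ∀ {a b} → + a ≈ + b → legendre a p ≡ legendre b p
    legendre-cong {a} {b} e = legendre-scale 1ℤ 1≉0 (≈-trans e (≈-reflexive (sym (*-identityˡ (+ b)))))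

    legendre-vanishing : ∀ {a} → + a ≈ 0ℤ → legendre a p ≡ 0ℤ
    legendre-vanishing {a} a≈0 = LegendreSpec-unique (legendre-spec a) (vanishing a≈0)

    -- l³ = l on {0, 1, -1}; the trailing j gives the left side the shape of a Jacobi symbol with p
    -- split off three times.
    LegendreSpec-cube : ∀ {c l} → LegendreSpec c l → ∀ j → l * (l * (l * j)) ≡ l * j
    LegendreSpec-cube (vanishing _)    j = refl
    LegendreSpec-cube (residue _ _ _)  j = trans (*-identityˡ (1ℤ * (1ℤ * j))) (*-identityˡ (1ℤ * j))
    LegendreSpec-cube (nonresidue _ _) j = cube j
      where
      cube : ∀ j → -1ℤ * (-1ℤ * (-1ℤ * j)) ≡ -1ℤ * j
      cube = solve-∀

    LegendreSpec-square≥0 : ∀ {c l} → LegendreSpec c l → 0ℤ ℤ.≤ l * l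
    LegendreSpec-square≥0 (vanishing _)    = ℤ.+≤+ ℕ.z≤n
    LegendreSpec-square≥0 (residue _ _ _)  = ℤ.+≤+ ℕ.z≤n
    LegendreSpec-square≥0 (nonresidue _ _) = ℤ.+≤+ ℕ.z≤n

    LegendreSpec-unit : ∀ {c l} → ¬ c ≈ 0ℤ → LegendreSpec c l → l ≡ 1ℤ ⊎ l ≡ -1ℤ
    LegendreSpec-unit c≉0 (vanishing c≈0)  = contradiction c≈0 c≉0
    LegendreSpec-unit c≉0 (residue _ _ _)  = inj₁ refl
    LegendreSpec-unit c≉0 (nonresidue _ _) = inj₂ refl

  -- Change of sign in the Legendre symbol for p ≡ 3 (mod 4)

  module _ {p} (p-prime : Prime p) (p%4≡3 : p ℕ.% 4 ≡ 3) where
    private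
      p≢2 : p ≢ 2
      p≢2 refl = case p%4≡3 of λ ()

    open OddPrimeModulus p-prime (odd⇒2≉0 p-prime p≢2)
    open LegendreSymbol p-prime

    private
      signedSquare : Bool → ℤ → ℤ
      signedSquare s x = if s then x * x else - (x * x)

      signed : Fin p → Fin p
      signed x = red (signedSquare (inLowerHalf x) (val x))

    -- As -1 is not a square, x ↦ ±x², with the sign + exactly on the lower
    -- half, is injective, hence surjective.
    square-or-negated-square : ∀ c → ∃ λ y → y * y ≈ c ⊎ - (y * y) ≈ c
    square-or-negated-square c =
      let x , e = injective⇒surjective signed-injective (red c)
      in val x , from-signed (inLowerHalf x) x
           (≈-trans (≈-sym (val-red (signedSquare (inLowerHalf x) (val x)))) (≈-trans (≈-reflexive (cong val e)) (val-red c)))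
      where
      from-signed : ∀ s x → signedSquare s (val x) ≈ c → val x * val x ≈ c ⊎ - (val x * val x) ≈ c
      from-signed true  x e = inj₁ e
      from-signed false x e = inj₂ e

      mixed : ∀ x y → x * x ≈ - (y * y) → x ≈ y
      mixed x y e = ≈-trans x≈0 (≈-sym y≈0)
        where
        x²+y²≈0 : x * x + y * y ≈ 0ℤ
        x²+y²≈0 = ≈-trans (≈-reflexive (cong (λ z → x * x + z) (sym (ℤ.neg-involutive (y * y))))) (≈⇒-≈0 e)
        y≈0 = a²+b²≈0⇒b≈0 p-prime (p≡3⇒no-√-1 p-prime p%4≡3) x y x²+y²≈0
        x≈0 = a²+b²≈0⇒b≈0 p-prime (p≡3⇒no-√-1 p-prime p%4≡3) y x (≈-trans (≈-reflexive (ℤ.+-comm (y * y) (x * x))) x²+y²≈0)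

      separate : ∀ {x y} s t → inLowerHalf x ≡ s → inLowerHalf y ≡ t →
                 signedSquare s (val x) ≈ signedSquare t (val y) → x ≡ y
      separate {x} {y} true true x-low y-low e = inLowerHalf-unique (squares≈⇒≈± e) (trans x-low (sym y-low))
      separate {x} {y} false false x-high y-high e = inLowerHalf-unique
        (squares≈⇒≈± (≈-trans (≈-reflexive (sym (ℤ.neg-involutive (val x * val x)))) (≈-trans (neg-cong e) (≈-reflexive (ℤ.neg-involutive (val y * val y))))))
        (trans x-high (sym y-high))
      separate {x} {y} true false _ _ e = val-injective (mixed (val x) (val y) e)
      separate {x} {y} false true _ _ e = val-injective (≈-sym (mixed (val y) (val x) (≈-sym e)))

      signed-injective : Injective _≡_ _≡_ signed
      signed-injective {x} {y} e = separate (inLowerHalf x) (inLowerHalf y) refl refl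
        (≈-trans (≈-sym (val-red (signedSquare (inLowerHalf x) (val x))))
          (≈-trans (≈-reflexive (cong val e)) (val-red (signedSquare (inLowerHalf y) (val y)))))

    -- Roots of both d and -d would give two squares with sum 0, forcing d ≈ 0. When d has no root,
    -- a root of c ≈ -d must be produced: c is a square or a negated square, and c ≈ -y² would make
    -- y a root of d.
    LegendreSpec-neg : ∀ {c d s} → c ≈ - d → LegendreSpec d s → LegendreSpec c (- s)
    LegendreSpec-neg {c} {d} c≈-d = λ where
        (vanishing d≈0) → vanishing (≈-trans c≈-d (neg-cong d≈0))
        (residue d≉0 y y²≈d) → nonresidue (c≉0 d≉0) λ z z²≈c → d≉0
          (≈-trans (≈-sym y²≈d) (*-cong {v = 0ℤ} (y≈0 y z (≈-trans z²≈c (≈-trans c≈-d (neg-cong (≈-sym y²≈d))))) (y≈0 y z (≈-trans z²≈c (≈-trans c≈-d (neg-cong (≈-sym y²≈d)))))))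
        (nonresidue d≉0 none) → let y , ±y²≈c = square-or-negated-square c in
          [ residue (c≉0 d≉0) y
          , (λ -y²≈c → contradiction
              (≈-trans (≈-reflexive (sym (ℤ.neg-involutive (y * y)))) (≈-trans (neg-cong (≈-trans -y²≈c c≈-d)) (≈-reflexive (ℤ.neg-involutive d))))
              (none y))
          ]′ ±y²≈c
      where
      c≉0 : ¬ d ≈ 0ℤ → ¬ c ≈ 0ℤ
      c≉0 d≉0 c≈0 = d≉0 (≈-trans (≈-reflexive (sym (ℤ.neg-involutive d))) (neg-cong (≈-trans (≈-sym c≈-d) c≈0)))
      y≈0 : ∀ y z → z * z ≈ - (y * y) → y ≈ 0ℤ
      y≈0 y z e = a²+b²≈0⇒b≈0 p-prime (p≡3⇒no-√-1 p-prime p%4≡3) z y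
        (≈-trans (≈-reflexive (cong (λ w → z * z + w) (sym (ℤ.neg-involutive (y * y))))) (≈⇒-≈0 e))

    legendre-neg : ∀ {a b} → + a ≈ - + b → legendre a p ≡ - legendre b p
    legendre-neg {a} {b} e = LegendreSpec-unique (legendre-spec a) (LegendreSpec-neg e (legendre-spec b))

  -- Character sums and the Jacobi symbol

  cubic : ℕ → ℕ
  cubic x = x ℕ.* (x ℕ.* x ℕ.+ 1)

  pos-cubic : ∀ x → + cubic x ≡ + x * (+ x * + x + 1ℤ)
  pos-cubic x = trans (pos-* x (x ℕ.* x ℕ.+ 1)) (cong (λ s → + x * (s + 1ℤ)) (pos-* x x))

  module _ (n : ℕ) .{{_ : NonZero n}} where
    open Modular n

    cubic-cong : ∀ {x} z → + x ≈ z → + cubic x ≈ z * (z * z + 1ℤ)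
    cubic-cong {x} z x≈z = ≈-trans (≈-reflexive (pos-cubic x)) (*-cong x≈z (+-cong (*-cong x≈z x≈z) (≈-refl {1ℤ})))

  ∑-const : ∀ k c → ∑[ i < k ] c ≡ + k * c
  ∑-const zero    c = refl
  ∑-const (suc k) c = trans (cong (λ z → c + z) (∑-const k c)) (sym (ℤ.suc-* (+ k) c))

  ∑-nonneg : ∀ {n} (t : Fin n → ℤ) → (∀ i → 0ℤ ℤ.≤ t i) → 0ℤ ℤ.≤ sum t
  ∑-nonneg {zero}  t t≥0 = ℤ.≤-refl
  ∑-nonneg {suc n} t t≥0 = ℤ.+-mono-≤ (t≥0 zero) (∑-nonneg (t ∘ suc) (t≥0 ∘ suc))

  term≤∑ : ∀ {n} (t : Fin n → ℤ) → (∀ i → 0ℤ ℤ.≤ t i) → ∀ a → t a ℤ.≤ sum t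
  term≤∑ {suc n} t t≥0 zero    = subst (ℤ._≤ sum t) (+-identityʳ (t zero)) (ℤ.+-monoʳ-≤ (t zero) (∑-nonneg (t ∘ suc) (t≥0 ∘ suc)))
  term≤∑ {suc n} t t≥0 (suc a) = ℤ.≤-trans (term≤∑ (t ∘ suc) (t≥0 ∘ suc) a)
    (subst (ℤ._≤ sum t) (+-identityˡ (sum (t ∘ suc))) (ℤ.+-monoˡ-≤ (sum (t ∘ suc)) (t≥0 zero)))

  ≡-⇒≡0 : ∀ s → s ≡ - s → s ≡ 0ℤ
  ≡-⇒≡0 (+ zero) _ = refl

  legendreSum : ℕ → ℤ
  legendreSum p = ∑[ x < p ] legendre (cubic (toℕ x)) p

  -- The number of residues at which the cubic is a unit modulo p. It enters the local factor of a
  -- prime dividing n exactly twice.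
  legendreSquareSum : ℕ → ℤ
  legendreSquareSum p = ∑[ x < p ] (legendre (cubic (toℕ x)) p * legendre (cubic (toℕ x)) p)

  module _ {p} (p-prime : Prime p) (p≢2 : p ≢ 2) where
    open OddPrimeModulus p-prime (odd⇒2≉0 p-prime p≢2)
    open LegendreSymbol p-prime

    private
      one = red 1ℤ
      L : Fin p → ℤ
      L x = legendre (cubic (toℕ x)) p
      L-spec : ∀ x → LegendreSpec (+ cubic (toℕ x)) (L x)
      L-spec x = legendre-spec (cubic (toℕ x))
      cubic[one]≈2 : + cubic (toℕ one) ≈ + 2
      cubic[one]≈2 = cubic-cong p {toℕ one} 1ℤ (val-red 1ℤ)
      L[one]-unit : L one ≡ 1ℤ ⊎ L one ≡ -1ℤ
      L[one]-unit = LegendreSpec-unit (λ e → odd⇒2≉0 p-prime p≢2 (≈-trans (≈-sym cubic[one]≈2) e)) (L-spec one)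
      cubic-val : ∀ x → + cubic (toℕ x) ≈ val x * (val x * val x + 1ℤ)
      cubic-val x = cubic-cong p {toℕ x} (val x) ≈-refl

    -- The terms are nonnegative, and the one at x = 1, where the cubic takes the unit value 2,
    -- equals 1.
    legendreSquareSum≢0 : legendreSquareSum p ≢ 0ℤ
    legendreSquareSum≢0 ∑≡0 = case ℤ.≤-trans (ℤ.≤-reflexive (sym (square L[one]-unit)))
        (ℤ.≤-trans (term≤∑ (λ x → L x * L x) (λ x → LegendreSpec-square≥0 (L-spec x)) one) (ℤ.≤-reflexive ∑≡0)) of λ { (ℤ.+≤+ ()) }
      where
      square : ∀ {l} → l ≡ 1ℤ ⊎ l ≡ -1ℤ → l * l ≡ 1ℤ
      square (inj₁ refl) = refl
      square (inj₂ refl) = refl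

    legendreSum≡0 : p ℕ.% 4 ≡ 3 → legendreSum p ≡ 0ℤ
    legendreSum≡0 p%4≡3 = ≡-⇒≡0 (sum L) (begin
      sum L                    ≡⟨ ∑-reindex (involutive⇒injective {σ = neg} neg-involutive) L ⟨
      ∑[ x < p ] L (neg x)     ≡⟨ sum-cong-≗ L-neg ⟩
      ∑[ x < p ] (-1ℤ * L x)   ≡⟨ *-distribˡ-sum -1ℤ L ⟨
      -1ℤ * sum L              ≡⟨ ℤ.-1*i≡-i (sum L) ⟩
      - sum L                  ∎)
      where
      open ≡-Reasoning
      odd : ∀ x → - x * (- x * - x + 1ℤ) ≡ - (x * (x * x + 1ℤ))
      odd = solve-∀
      L-neg : ∀ x → L (neg x) ≡ -1ℤ * L x
      L-neg x = trans (legendre-neg p-prime p%4≡3 (≈-trans (cubic-cong p {toℕ (neg x)} (- val x) (val-red (- val x)))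
        (≈-trans (≈-reflexive (odd (val x))) (neg-cong (≈-sym (cubic-val x)))))) (sym (ℤ.-1*i≡-i (L x)))

    -- The cubic vanishes at 0 and at ±√-1, as `∑-mod-4` demands, and its value 2 at x = 1 has
    -- symbol ±1; the sum is therefore 4k ± 2.
    legendreSum≢0 : p ℕ.% 4 ≡ 1 → legendreSum p ≢ 0ℤ
    legendreSum≢0 p%4≡1 ∑≡0 = not-multiple-of-4 L[one]-unit (trans (sym ∑≡0) ∑≡4k+2l)
      where
      i = proj₁ (p≡1⇒√-1 p-prime p%4≡1)
      i²≈-1 = proj₂ (p≡1⇒√-1 p-prime p%4≡1)
      i≉0 : ¬ i ≈ 0ℤ
      i≉0 i≈0 = 1≉0 (neg-cong (≈-trans (≈-sym i²≈-1) (*-cong i≈0 i≈0)))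

      L-zero : ∀ {x} → val x ≈ 0ℤ → L x ≡ 0ℤ
      L-zero {x} x≈0 = legendre-vanishing (cubic-cong p {toℕ x} 0ℤ x≈0)

      L-neg : ∀ {x y} → val x ≈ - val y → L x ≡ L y
      -- The sign coming from the odd cubic is the square i², which the symbol ignores.
      L-neg {x} {y} x≈-y = legendre-scale i i≉0 (≈-trans (cubic-cong p {toℕ x} (- val y) x≈-y)
        (≈-trans (≈-reflexive (odd (val y)))
        (*-cong (≈-sym i²≈-1) (≈-sym (cubic-val y)))))
        where
        odd : ∀ y → - y * (- y * - y + 1ℤ) ≡ -1ℤ * (y * (y * y + 1ℤ))
        odd = solve-∀

      -- x (x² + 1) = (x²)² y (y² + 1) when x y = 1.
      L-inv : ∀ {x y} → val x * val y ≈ 1ℤ → L x ≡ L y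
      L-inv {x} {y} xy≈1 = legendre-scale (val x * val x) (x≉0 ∘ square≈0) (≈-trans (cubic-val x)
        (≈-trans (≈-sym (≈-trans (≈-reflexive (regroup (val x) (val y)))
          (≈-trans (*-cong (*-congˡ (val x) xy≈1) (+-cong (*-cong xy≈1 xy≈1) (≈-refl {val x * val x}))) (≈-reflexive (simplify (val x))))))
        (*-congˡ (val x * val x * (val x * val x)) (≈-sym (cubic-val y)))))
        where
        x≉0 : ¬ val x ≈ 0ℤ
        x≉0 = unit≉0 {val x} {val y} xy≈1
        regroup : ∀ x y → x * x * (x * x) * (y * (y * y + 1ℤ)) ≡ x * (x * y) * ((x * y) * (x * y) + x * x)
        regroup = solve-∀
        simplify : ∀ x → x * 1ℤ * (1ℤ * 1ℤ + x * x) ≡ x * (x * x + 1ℤ)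
        simplify = solve-∀

      L-√-1 : ∀ {x} → val x * val x ≈ -1ℤ → L x ≡ 0ℤ
      L-√-1 {x} x²≈-1 = legendre-vanishing (≈-trans (cubic-val x)
        (≈-trans (*-congˡ (val x) (+-cong x²≈-1 (≈-refl {1ℤ}))) (≈-reflexive (*-zeroʳ (val x)))))

      counted : ∃ λ k → sum L ≡ + 4 * k + + 2 * L one
      counted = ∑-mod-4 L L-zero (λ {x} {y} → L-neg {x} {y}) (λ {x} {y} → L-inv {x} {y}) (λ {x} → L-√-1 {x})
      k = proj₁ counted
      ∑≡4k+2l : sum L ≡ + 4 * k + + 2 * L one
      ∑≡4k+2l = proj₂ counted
      not-multiple-of-4 : ∀ {l} → l ≡ 1ℤ ⊎ l ≡ -1ℤ → 0ℤ ≢ + 4 * k + + 2 * l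
      not-multiple-of-4 (inj₁ refl) e = from-no (Mod4._≈?_ 0ℤ (+ 2)) (Mod4.≈-witness k (trans e (trans (ℤ.+-comm (+ 4 * k) (+ 2)) (cong (λ z → + 2 + z) (*-comm (+ 4) k)))))
      not-multiple-of-4 (inj₂ refl) e = from-no (Mod4._≈?_ 0ℤ (- + 2)) (Mod4.≈-witness k (trans e (trans (ℤ.+-comm (+ 4 * k) (- + 2)) (cong (λ z → - + 2 + z) (*-comm (+ 4) k)))))

  -- Sums of periodic functions over coprime moduli

  Periodic : ℕ → (ℕ → ℤ) → Set
  Periodic n F = ∀ {x y} → + x ≈ + y [mod n ] → F x ≡ F y

  module _ {m} .{{_ : NonZero m}} {G : ℕ → ℤ} (G-periodic : Periodic m G) where
    open Modular m

    ∑-periodic : ∀ k → ∑[ x < k ℕ.* m ] G (toℕ x) ≡ + k * ∑[ x < m ] G (toℕ x)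
    ∑-periodic k = begin
      ∑[ x < k ℕ.* m ] G (toℕ x)                   ≡⟨ ∑-combine k m (G ∘ toℕ) ⟩
      ∑[ i < k ] ∑[ j < m ] G (toℕ (combine i j))  ≡⟨ sum-cong-≗ (λ i → sum-cong-≗ λ j → G-periodic (shift i j)) ⟩
      ∑[ i < k ] ∑[ j < m ] G (toℕ j)              ≡⟨ ∑-const k _ ⟩
      + k * ∑[ x < m ] G (toℕ x)                   ∎
      where
      open ≡-Reasoning
      shift : ∀ (i : Fin k) (j : Fin m) → + toℕ (combine i j) ≈ + toℕ j
      shift i j = ≈-witness (+ toℕ i) (begin
        + toℕ (combine i j)             ≡⟨ cong +_ (toℕ-combine i j) ⟩
        + (m ℕ.* toℕ i ℕ.+ toℕ j)       ≡⟨ cong (λ z → z + + toℕ j) (pos-* m (toℕ i)) ⟩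
        + m * + toℕ i + + toℕ j         ≡⟨ regroup (+ m) (+ toℕ i) (+ toℕ j) ⟩
        + toℕ j + + toℕ i * + m         ∎)
        where
        regroup : ∀ m i j → m * i + j ≡ j + i * m
        regroup = solve-∀

    -- As q is a unit modulo m, x ↦ qx + c permutes the residues.
    ∑-progression : ∀ {q} → Coprime m q → ∀ c → ∑[ x < m ] G (q ℕ.* toℕ x ℕ.+ c) ≡ ∑[ x < m ] G (toℕ x)
    ∑-progression {q} m⊥q c = begin
      ∑[ x < m ] G (q ℕ.* toℕ x ℕ.+ c)  ≡⟨ sum-cong-≗ (λ x → G-periodic (≈-sym (≈-trans (val-red (affine x)) (≈-reflexive (sym (pos-affine x)))))) ⟩
      ∑[ x < m ] G (toℕ (red (affine x))) ≡⟨ ∑-reindex injective (G ∘ toℕ) ⟩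
      ∑[ x < m ] G (toℕ x)              ∎
      where
      open ≡-Reasoning
      affine : Fin m → ℤ
      affine x = + q * + toℕ x + + c
      pos-affine : ∀ x → + (q ℕ.* toℕ x ℕ.+ c) ≡ affine x
      pos-affine x = cong (λ z → z + + c) (pos-* q (toℕ x))
      difference : ∀ q x y c → (q * x + c) - (q * y + c) ≡ q * (x - y)
      difference = solve-∀
      injective : Injective _≡_ _≡_ (red ∘ affine)
      injective {x} {y} e = val-injective (congruent (∣ᵤ⇒∣ (ℤ.coprime-divisor (+ m) (+ q) (val x - val y) m⊥q
        (∣⇒∣ᵤ (≈0⇒∣ (≈-trans (≈-reflexive (sym (difference (+ q) (val x) (val y) (+ c))))
          (≈⇒-≈0 (≈-trans (≈-sym (val-red (affine x))) (≈-trans (≈-reflexive (cong val e)) (val-red (affine y)))))))))))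

  -- The Chinese remainder theorem in summed form: for x = pj + i, F sees only i, while for fixed i
  -- the argument of G runs through a progression of step p prime to m, covering every residue k
  -- times. The factor k permits ranges longer than one period: k = 1 serves for a single prime p, k
  -- = p for p².
  ∑-product : ∀ {p m} .{{_ : NonZero p}} .{{_ : NonZero m}} {F G : ℕ → ℤ} →
              Periodic p F → Periodic m G → Coprime m p → ∀ k →
              ∑[ x < k ℕ.* m ℕ.* p ] (F (toℕ x) * G (toℕ x)) ≡
              ∑[ x < p ] F (toℕ x) * (+ k * ∑[ x < m ] G (toℕ x))
  ∑-product {p} {m} {F} {G} F-periodic G-periodic m⊥p k = begin
    ∑[ x < k ℕ.* m ℕ.* p ] (F (toℕ x) * G (toℕ x))
      ≡⟨ ∑-combine (k ℕ.* m) p (λ x → F (toℕ x) * G (toℕ x)) ⟩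
    ∑[ j < k ℕ.* m ] ∑[ i < p ] (F (toℕ (combine j i)) * G (toℕ (combine j i)))
      ≡⟨ sum-cong-≗ (λ j → sum-cong-≗ λ i → cong₂ _*_ (F-periodic (shift j i)) (cong G (toℕ-combine j i))) ⟩
    ∑[ j < k ℕ.* m ] ∑[ i < p ] (F (toℕ i) * G (p ℕ.* toℕ j ℕ.+ toℕ i))
      ≡⟨ ∑-comm (λ (j : Fin (k ℕ.* m)) (i : Fin p) → F (toℕ i) * G (p ℕ.* toℕ j ℕ.+ toℕ i)) ⟩
    ∑[ i < p ] ∑[ j < k ℕ.* m ] (F (toℕ i) * G (p ℕ.* toℕ j ℕ.+ toℕ i))
      ≡⟨ sum-cong-≗ inner ⟩
    ∑[ i < p ] (F (toℕ i) * (+ k * ∑[ x < m ] G (toℕ x)))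
      ≡⟨ *-distribʳ-sum {p} (+ k * ∑[ x < m ] G (toℕ x)) (λ x → F (toℕ x)) ⟨
    ∑[ x < p ] F (toℕ x) * (+ k * ∑[ x < m ] G (toℕ x))
      ∎
    where
    open ≡-Reasoning
    module Modp = Modular p
    module Modm = Modular m
    shift : ∀ (j : Fin (k ℕ.* m)) (i : Fin p) → + toℕ (combine j i) ≈ + toℕ i [mod p ]
    shift j i = Modp.≈-witness (+ toℕ j) (begin
      + toℕ (combine j i)             ≡⟨ cong +_ (toℕ-combine j i) ⟩
      + (p ℕ.* toℕ j ℕ.+ toℕ i)       ≡⟨ cong (λ z → z + + toℕ i) (pos-* p (toℕ j)) ⟩
      + p * + toℕ j + + toℕ i         ≡⟨ regroup (+ p) (+ toℕ j) (+ toℕ i) ⟩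
      + toℕ i + + toℕ j * + p         ∎)
      where
      regroup : ∀ p j i → p * j + i ≡ i + j * p
      regroup = solve-∀
    translate-periodic : ∀ (i : Fin p) → Periodic m (λ x → G (p ℕ.* x ℕ.+ toℕ i))
    translate-periodic i {x} {y} x≈y = G-periodic (Modm.≈-trans (Modm.≈-reflexive (cong (λ z → z + + toℕ i) (pos-* p x)))
      (Modm.≈-trans (Modm.+-cong (Modm.*-congˡ (+ p) x≈y) (Modm.≈-refl {+ toℕ i})) (Modm.≈-reflexive (sym (cong (λ z → z + + toℕ i) (pos-* p y))))))
    inner : ∀ i → ∑[ j < k ℕ.* m ] (F (toℕ i) * G (p ℕ.* toℕ j ℕ.+ toℕ i)) ≡ F (toℕ i) * (+ k * ∑[ x < m ] G (toℕ x))
    inner i = begin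
      ∑[ j < k ℕ.* m ] (F (toℕ i) * G (p ℕ.* toℕ j ℕ.+ toℕ i))
        ≡⟨ *-distribˡ-sum (F (toℕ i)) (λ (j : Fin (k ℕ.* m)) → G (p ℕ.* toℕ j ℕ.+ toℕ i)) ⟨
      F (toℕ i) * ∑[ j < k ℕ.* m ] G (p ℕ.* toℕ j ℕ.+ toℕ i)
        ≡⟨ cong (F (toℕ i) *_) (∑-periodic {G = λ x → G (p ℕ.* x ℕ.+ toℕ i)} (translate-periodic i) k) ⟩
      F (toℕ i) * (+ k * ∑[ x < m ] G (p ℕ.* toℕ x ℕ.+ toℕ i))
        ≡⟨ cong (λ s → F (toℕ i) * (+ k * s)) (∑-progression {G = G} G-periodic m⊥p (toℕ i)) ⟩
      F (toℕ i) * (+ k * ∑[ x < m ] G (toℕ x)) ∎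

  -- The Jacobi symbol under change of factorisation and of argument

  legendreProduct : ℕ → List ℕ → ℤ
  legendreProduct a = foldr (λ p r → legendre a p * r) 1ℤ

  legendreProduct-↭ : ∀ a {ps qs} → ps ↭ qs → legendreProduct a ps ≡ legendreProduct a qs
  legendreProduct-↭ a ↭.refl = refl
  legendreProduct-↭ a (↭.prep p ps↭qs) = cong (legendre a p *_) (legendreProduct-↭ a ps↭qs)
  legendreProduct-↭ a (↭.swap p q ps↭qs) = trans
    (cong (λ r → legendre a p * (legendre a q * r)) (legendreProduct-↭ a ps↭qs))
    (exchange (legendre a p) (legendre a q) _)
    where
    exchange : ∀ x y z → x * (y * z) ≡ y * (x * z)
    exchange = solve-∀
  legendreProduct-↭ a (↭.trans ps↭qs qs↭rs) = trans (legendreProduct-↭ a ps↭qs) (legendreProduct-↭ a qs↭rs)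

  -- Unique factorisation matches the list chosen by `factorise` with any other up to permutation.
  -- This allows a prescribed prime p to be placed in front.
  jacobi≡legendreProduct : ∀ a n .{{_ : NonZero n}} (f : PrimeFactorisation n) → jacobi a n ≡ legendreProduct a (factors f)
  jacobi≡legendreProduct a n@(suc _) f = legendreProduct-↭ a (factorisationUnique (factorise n) f)

  jacobi-* : ∀ a {p} m .{{_ : NonZero m}} → Prime p → jacobi a (p ℕ.* m) ≡ legendre a p * jacobi a m
  jacobi-* a {p} m p-prime = trans
    (jacobi≡legendreProduct a (p ℕ.* m) record
      { factors         = p ∷ factors f
      ; isFactorisation = cong (p ℕ.*_) (PrimeFactorisation.isFactorisation f)
      ; factorsPrime    = p-prime ∷ PrimeFactorisation.factorsPrime f
      })
    (cong (legendre a p *_) (sym (jacobi≡legendreProduct a m f)))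
    where
    f = factorise m
    instance _ = prime⇒nonZero p-prime
             _ = ℕ.m*n≢0 p m

  jacobi-periodic : ∀ n .{{_ : NonZero n}} → Periodic n (λ a → jacobi a n)
  jacobi-periodic n {a} {b} a≈b = trans (jacobi≡legendreProduct a n f) (trans
    (go (factors f) (PrimeFactorisation.factorsPrime f) ∏∣)
    (sym (jacobi≡legendreProduct b n f)))
    where
    f = factorise n
    ∏∣ : + product (factors f) ∣ + a - + b
    -- The congruence is restated for the product of the factor list, so that it can be split along
    -- with the list.
    ∏∣ = subst (λ k → + k ∣ + a - + b) (PrimeFactorisation.isFactorisation f) (_≈_[mod_].n∣x-y a≈b)
    go : ∀ ps → All Prime ps → + product ps ∣ + a - + b → legendreProduct a ps ≡ legendreProduct b ps
    go [] _ _ = refl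
    go (p ∷ ps) (p-prime ∷ ps-prime) d = cong₂ _*_
      (LegendreSymbol.legendre-cong p-prime (congruent (∣-trans (∣ᵤ⇒∣ (ℕ.m∣m*n (product ps))) d)))
      (go ps ps-prime (∣-trans (∣ᵤ⇒∣ (ℕ.n∣m*n p)) d))

  -- Induction on the modulus

  jacobiSum : ℕ → ℤ
  jacobiSum n = ∑[ x < n ] jacobi (cubic (toℕ x)) n

  cubic-preserves-≈ : ∀ n .{{_ : NonZero n}} {x y} → + x ≈ + y [mod n ] → + cubic x ≈ + cubic y [mod n ]
  cubic-preserves-≈ n {x} {y} x≈y = ≈-trans (cubic-cong n {x} (+ y) x≈y) (≈-reflexive (sym (pos-cubic y)))
    where open Modular n

  module _ {p} (p-prime : Prime p) (m : ℕ) .{{_ : NonZero m}} where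
    private
      instance
        p≢0 : NonZero p
        p≢0 = prime⇒nonZero p-prime
        pm≢0 : NonZero (p ℕ.* m)
        pm≢0 = ℕ.m*n≢0 p m

      L J : ℕ → ℤ
      L x = legendre (cubic x) p
      J x = jacobi (cubic x) m

      L-periodic : Periodic p L
      L-periodic {x} {y} x≈y = LegendreSymbol.legendre-cong p-prime (cubic-preserves-≈ p {x} {y} x≈y)

      J-periodic : Periodic m J
      J-periodic {x} {y} x≈y = jacobi-periodic m (cubic-preserves-≈ m {x} {y} x≈y)

    ∤⇒coprime : ¬ p ℕ.∣ m → Coprime m p
    ∤⇒coprime p∤m {d} (d∣m , d∣p) =
      [ id , (λ d≡p → contradiction (subst (ℕ._∣ m) d≡p d∣m) p∤m) ]′ (prime⇒irreducible p-prime d∣p)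

    jacobiSum-coprime : ¬ p ℕ.∣ m → jacobiSum (p ℕ.* m) ≡ legendreSum p * jacobiSum m
    jacobiSum-coprime p∤m = begin
      jacobiSum (p ℕ.* m)
        ≡⟨ sum-cong-≗ {p ℕ.* m} (λ x → jacobi-* (cubic (toℕ x)) m p-prime) ⟩
      ∑[ x < p ℕ.* m ] (L (toℕ x) * J (toℕ x))
        -- The range is written as 1 · m · p to match the form k · m · p of `∑-product`.
        ≡⟨ cong (λ n → ∑[ x < n ] (L (toℕ x) * J (toℕ x))) (trans (ℕ.*-comm p m) (cong (ℕ._* p) (sym (ℕ.*-identityˡ m)))) ⟩
      ∑[ x < 1 ℕ.* m ℕ.* p ] (L (toℕ x) * J (toℕ x))
        ≡⟨ ∑-product {F = L} {J} (λ {x} {y} → L-periodic {x} {y}) (λ {x} {y} → J-periodic {x} {y}) (∤⇒coprime p∤m) 1 ⟩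
      legendreSum p * (1ℤ * jacobiSum m)
        ≡⟨ cong (λ s → legendreSum p * s) (*-identityˡ (jacobiSum m)) ⟩
      legendreSum p * jacobiSum m ∎
      where open ≡-Reasoning

    private
      jacobi-p² : ∀ a → jacobi a (p ℕ.* (p ℕ.* m)) ≡ legendre a p * (legendre a p * jacobi a m)
      jacobi-p² a = trans (jacobi-* a (p ℕ.* m) p-prime) (cong (λ j → legendre a p * j) (jacobi-* a m p-prime))

    jacobiSum-square-coprime : ¬ p ℕ.∣ m → jacobiSum (p ℕ.* (p ℕ.* m)) ≡ legendreSquareSum p * (+ p * jacobiSum m)
    jacobiSum-square-coprime p∤m = begin
      jacobiSum (p ℕ.* (p ℕ.* m))
        ≡⟨ sum-cong-≗ {p ℕ.* (p ℕ.* m)} (λ x → trans (jacobi-p² (cubic (toℕ x))) (sym (*-assoc (L (toℕ x)) (L (toℕ x)) (J (toℕ x))))) ⟩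
      ∑[ x < p ℕ.* (p ℕ.* m) ] (L² (toℕ x) * J (toℕ x))
        ≡⟨ cong (λ n → ∑[ x < n ] (L² (toℕ x) * J (toℕ x))) (ℕ.*-comm p (p ℕ.* m)) ⟩
      ∑[ x < p ℕ.* m ℕ.* p ] (L² (toℕ x) * J (toℕ x))
        ≡⟨ ∑-product {F = L²} {J} (λ {x} {y} → L²-periodic {x} {y}) (λ {x} {y} → J-periodic {x} {y}) (∤⇒coprime p∤m) p ⟩
      legendreSquareSum p * (+ p * jacobiSum m) ∎
      where
      open ≡-Reasoning
      L² : ℕ → ℤ
      L² x = L x * L x
      L²-periodic : Periodic p L²
      L²-periodic {x} {y} x≈y = cong (λ l → l * l) (L-periodic {x} {y} x≈y)

    -- The symbol modulo m already contains the Legendre symbol l of p, so the two further copies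
    -- disappear by l³ = l. What remains has period m, and the range consists of p² periods.
    jacobiSum-square-divisible : p ℕ.∣ m → jacobiSum (p ℕ.* (p ℕ.* m)) ≡ + (p ℕ.* p) * jacobiSum m
    jacobiSum-square-divisible (ℕ.divides k m≡kp) = begin
      jacobiSum (p ℕ.* (p ℕ.* m))
        ≡⟨ sum-cong-≗ {p ℕ.* (p ℕ.* m)} (λ x → trans (jacobi-p² (cubic (toℕ x))) (absorb (cubic (toℕ x)))) ⟩
      ∑[ x < p ℕ.* (p ℕ.* m) ] J (toℕ x)
        ≡⟨ cong (λ n → ∑[ x < n ] J (toℕ x)) (sym (ℕ.*-assoc p p m)) ⟩
      ∑[ x < p ℕ.* p ℕ.* m ] J (toℕ x)
        ≡⟨ ∑-periodic {G = J} (λ {x} {y} → J-periodic {x} {y}) (p ℕ.* p) ⟩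
      + (p ℕ.* p) * jacobiSum m ∎
      where
      open ≡-Reasoning
      open LegendreSymbol p-prime
      m≡pk : m ≡ p ℕ.* k
      m≡pk = trans m≡kp (ℕ.*-comm k p)
      k≢0 : NonZero k
      k≢0 = ℕ.≢-nonZero λ k≡0 → ℕ.≢-nonZero⁻¹ m (trans m≡kp (cong (ℕ._* p) k≡0))
      absorb : ∀ a → legendre a p * (legendre a p * jacobi a m) ≡ jacobi a m
      absorb a = trans (cong (λ j → legendre a p * (legendre a p * j)) jacobi≡)
        (trans (LegendreSpec-cube (legendre-spec a) (jacobi a k)) (sym jacobi≡))
        where
        jacobi≡ : jacobi a m ≡ legendre a p * jacobi a k
        jacobi≡ = trans (cong (jacobi a) m≡pk) (jacobi-* a k {{k≢0}} p-prime)

  -- The second half yields an actual representation from a nonvanishing sum. The negated form in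
  -- the theorem is recovered at the end, since equality of integers is decidable.
  Detected : ℕ → Set
  Detected n = (IsSumOfTwoSquares n → jacobiSum n ≢ 0ℤ) × (jacobiSum n ≢ 0ℤ → IsSumOfTwoSquares n)

  Detected-multiple : ∀ {m n c} → c ≢ 0ℤ → jacobiSum n ≡ c * jacobiSum m →
                      (IsSumOfTwoSquares n → IsSumOfTwoSquares m) → (IsSumOfTwoSquares m → IsSumOfTwoSquares n) →
                      Detected m → Detected n
  Detected-multiple {m} {n} {c} c≢0 S≡ down up (detects , detected) =
    (λ n-sum Sn≡0 → [ c≢0 , detects (down n-sum) ]′ (ℤ.i*j≡0⇒i≡0∨j≡0 c (trans (sym S≡) Sn≡0))) ,
    (λ Sn≢0 → up (detected λ Sm≡0 → Sn≢0 (trans S≡ (trans (cong (λ s → c * s) Sm≡0) (*-zeroʳ c)))))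

  odd⇒1or3[mod4] : ∀ n → ¬ 2 ℕ.∣ n → n ℕ.% 4 ≡ 1 ⊎ n ℕ.% 4 ≡ 3
  odd⇒1or3[mod4] n odd = go (n ℕ.% 4) refl (ℕ.m%n<n n 4)
    where
    2∣4q : 2 ℕ.∣ n ℕ./ 4 ℕ.* 4
    2∣4q = ℕ.∣n⇒∣m*n (n ℕ./ 4) (ℕ.divides 2 refl)
    even : ∀ {r} → n ℕ.% 4 ≡ r → 2 ℕ.∣ r → 2 ℕ.∣ n
    even n%4≡r 2∣r = subst (2 ℕ.∣_) (sym (ℕ.m≡m%n+[m/n]*n n 4)) (ℕ.∣m∣n⇒∣m+n (subst (2 ℕ.∣_) (sym n%4≡r) 2∣r) 2∣4q)
    go : ∀ r → n ℕ.% 4 ≡ r → r ℕ.< 4 → n ℕ.% 4 ≡ 1 ⊎ n ℕ.% 4 ≡ 3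
    go 0 e _ = contradiction (even e (ℕ.divides 0 refl)) odd
    go 1 e _ = inj₁ e
    go 2 e _ = contradiction (even e (ℕ.divides 1 refl)) odd
    go 3 e _ = inj₂ e
    go (suc (suc (suc (suc _)))) _ (ℕ.s≤s (ℕ.s≤s (ℕ.s≤s (ℕ.s≤s ()))))

  sumOfTwoSquares-p≡1 : ∀ {p} → Prime p → p ℕ.% 4 ≡ 1 → IsSumOfTwoSquares p
  sumOfTwoSquares-p≡1 p-prime p%4≡1 = let i , i²≈-1 = p≡1⇒√-1 p-prime p%4≡1 in √-1⇒sumOfTwoSquares p-prime {i} i²≈-1

  -- A prime p ≡ 1 is itself a sum of two squares and cancels twice, one factor at a time; for p ≡ 3
  -- a single descent removes both factors.
  sumOfTwoSquares-p²*⁻ : ∀ {p} → Prime p → ¬ 2 ℕ.∣ p → ∀ {m} → IsSumOfTwoSquares (p ℕ.* (p ℕ.* m)) → IsSumOfTwoSquares m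
  sumOfTwoSquares-p²*⁻ {p} p-prime p-odd {m} s = [ split , inert ]′ (odd⇒1or3[mod4] p p-odd)
    where
    split : p ℕ.% 4 ≡ 1 → IsSumOfTwoSquares m
    split p%4≡1 = cancel-p {m} (cancel-p {p ℕ.* m} s)
      where
      cancel-p : ∀ {m} → IsSumOfTwoSquares (p ℕ.* m) → IsSumOfTwoSquares m
      cancel-p = sumOfTwoSquares-quotient p-prime (sumOfTwoSquares-p≡1 p-prime p%4≡1)
    inert : p ℕ.% 4 ≡ 3 → IsSumOfTwoSquares m
    inert p%4≡3 = let k , pm≡pk , k-sum = sumOfTwoSquares-descent p-prime p%4≡3 s
                  in subst IsSumOfTwoSquares (sym (ℕ.*-cancelˡ-≡ m k p {{prime⇒nonZero p-prime}} pm≡pk)) k-sum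

  sumOfTwoSquares-p²*⁺ : ∀ p {m} → IsSumOfTwoSquares m → IsSumOfTwoSquares (p ℕ.* (p ℕ.* m))
  sumOfTwoSquares-p²*⁺ p {m} s = subst IsSumOfTwoSquares (ℕ.*-assoc p p m) (sumOfTwoSquares-* (sumOfTwoSquares-square p) s)

  prime-divisor : ∀ n → 1 ℕ.< n → ∃₂ λ p k → Prime p × n ≡ p ℕ.* k
  prime-divisor n@(suc _) 1<n = go (factorise n)
    where
    go : PrimeFactorisation n → ∃₂ λ p k → Prime p × n ≡ p ℕ.* k
    go record { factors = [] ; isFactorisation = n≡1 } = contradiction (sym n≡1) (ℕ.<⇒≢ 1<n)
    go record { factors = p ∷ ps ; isFactorisation = n≡ ; factorsPrime = p-prime ∷ _ } = p , product ps , p-prime , n≡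

  odd⇒detected : ∀ n → ¬ 2 ℕ.∣ n → Detected n
  odd⇒detected = <-rec (λ n → ¬ 2 ℕ.∣ n → Detected n) step
    where
    step : ∀ n → (∀ {m} → m ℕ.< n → ¬ 2 ℕ.∣ m → Detected m) → ¬ 2 ℕ.∣ n → Detected n
    step zero rec odd = contradiction (ℕ.divides 0 refl) odd
    -- The empty product of symbols gives S(1) = 1 by evaluation, and 1 = 1² + 0².
    step (suc zero) rec odd = (λ _ ()) , (λ _ → 1ℤ , 0ℤ , refl)
    step n@(suc (suc _)) rec odd =
      let p , k , p-prime , n≡pk = prime-divisor n (ℕ.s≤s (ℕ.s≤s ℕ.z≤n)) in peel p-prime k n≡pk
      where
      module _ {p} (p-prime : Prime p) where
        private
          instance
            p≢0 : NonZero p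
            p≢0 = prime⇒nonZero p-prime

        smaller : ∀ k .{{_ : NonZero k}} → k ℕ.< p ℕ.* k
        smaller k = subst (ℕ._< p ℕ.* k) (ℕ.*-identityˡ k) (ℕ.*-monoˡ-< k (ℕ.nonTrivial⇒n>1 p {{prime⇒nonTrivial p-prime}}))

        2∤p : ∀ {k} → n ≡ p ℕ.* k → ¬ 2 ℕ.∣ p
        2∤p {k} n≡pk 2∣p = odd (subst (2 ℕ.∣_) (sym n≡pk) (ℕ.∣m⇒∣m*n k 2∣p))

        p≢2 : ∀ {k} → n ≡ p ℕ.* k → p ≢ 2
        p≢2 {k} n≡pk refl = 2∤p {k} n≡pk ℕ.∣-refl

        -- For p ≡ 3 both implications hold vacuously: a representation of pk would force p to
        -- divide k, and the local factor of p makes the sum 0. For p ≡ 1 the local factor is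
        -- nonzero and p is a sum of two squares, so both properties pass to k and back.
        peel-once : ∀ k .{{_ : NonZero k}} → n ≡ p ℕ.* k → ¬ p ℕ.∣ k → Detected n
        peel-once k n≡pk p∤k = subst Detected (sym n≡pk) ([ split , inert ]′ (odd⇒1or3[mod4] p (2∤p {k} n≡pk)))
          where
          split : p ℕ.% 4 ≡ 1 → Detected (p ℕ.* k)
          split p%4≡1 = Detected-multiple {k} {p ℕ.* k} (legendreSum≢0 p-prime (p≢2 {k} n≡pk) p%4≡1) (jacobiSum-coprime p-prime k p∤k)
            (sumOfTwoSquares-quotient p-prime p-sum) (sumOfTwoSquares-* {p} {k} p-sum)
            (rec (subst (k ℕ.<_) (sym n≡pk) (smaller k)) λ 2∣k → odd (subst (2 ℕ.∣_) (sym n≡pk) (ℕ.∣n⇒∣m*n p 2∣k)))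
            where
            p-sum = sumOfTwoSquares-p≡1 p-prime p%4≡1
          inert : p ℕ.% 4 ≡ 3 → Detected (p ℕ.* k)
          inert p%4≡3 =
            (λ pk-sum → let j , k≡pj , _ = sumOfTwoSquares-descent p-prime p%4≡3 pk-sum
                        in contradiction (ℕ.divides j (trans k≡pj (ℕ.*-comm p j))) p∤k) ,
            (λ S≢0 → contradiction
              (trans (jacobiSum-coprime p-prime k p∤k) (cong (λ s → s * jacobiSum k) (legendreSum≡0 p-prime (p≢2 {k} n≡pk) p%4≡3)))
              S≢0)

        -- Whether p divides m affects only the nonzero constant between the two sums: p² if it
        -- does, and p times the sum of squared symbols if it does not.
        peel-twice : ∀ m .{{_ : NonZero m}} → n ≡ p ℕ.* (p ℕ.* m) → Detected n
        peel-twice m n≡ppm = subst Detected (sym n≡ppm) (go (p ℕ.∣? m))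
          where
          instance _ = ℕ.m*n≢0 p m
          +≢0 : ∀ k .{{_ : NonZero k}} → + k ≢ 0ℤ
          +≢0 k e = ℕ.≢-nonZero⁻¹ k (ℤ.+-injective e)
          m-detected : Detected m
          m-detected = rec (subst (m ℕ.<_) (sym n≡ppm) (ℕ.<-trans (smaller m) (smaller (p ℕ.* m))))
            λ 2∣m → odd (subst (2 ℕ.∣_) (sym n≡ppm) (ℕ.∣n⇒∣m*n p (ℕ.∣n⇒∣m*n p 2∣m)))
          via : ∀ {c} → c ≢ 0ℤ → jacobiSum (p ℕ.* (p ℕ.* m)) ≡ c * jacobiSum m → Detected (p ℕ.* (p ℕ.* m))
          via c≢0 S≡ = Detected-multiple {m} c≢0 S≡
            (sumOfTwoSquares-p²*⁻ p-prime (2∤p {p ℕ.* m} n≡ppm) {m}) (sumOfTwoSquares-p²*⁺ p {m}) m-detected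
          go : Dec (p ℕ.∣ m) → Detected (p ℕ.* (p ℕ.* m))
          go (yes p∣m) = via (+≢0 (p ℕ.* p) {{ℕ.m*n≢0 p p}}) (jacobiSum-square-divisible p-prime m p∣m)
          go (no  p∤m) = via {legendreSquareSum p * + p}
            (λ e → [ legendreSquareSum≢0 p-prime (p≢2 {p ℕ.* m} n≡ppm) , +≢0 p ]′ (ℤ.i*j≡0⇒i≡0∨j≡0 (legendreSquareSum p) e))
            (trans (jacobiSum-square-coprime p-prime m p∤m) (sym (*-assoc (legendreSquareSum p) (+ p) (jacobiSum m))))

        peel : ∀ k → n ≡ p ℕ.* k → Detected n
        peel zero      n≡0  = contradiction (trans n≡0 (ℕ.*-zeroʳ p)) λ ()
        peel k@(suc _) n≡pk = go (p ℕ.∣? k)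
          where
          go : Dec (p ℕ.∣ k) → Detected n
          go (no p∤k)                   = peel-once k n≡pk p∤k
          go (yes (ℕ.divides m k≡mp)) = peel-twice m
            {{ℕ.≢-nonZero λ m≡0 → case trans k≡mp (cong (ℕ._* p) m≡0) of λ ()}}
            (trans n≡pk (cong (p ℕ.*_) (trans k≡mp (ℕ.*-comm m p))))

  nonSum⇔jacobiSum≡0 : ∀ n → ¬ 2 ℕ.∣ n → (¬ IsSumOfTwoSquares n) ⇔ (jacobiSum n ≡ 0ℤ)
  nonSum⇔jacobiSum≡0 n odd = mk⇔
    (λ ¬sum → decidable-stable (jacobiSum n ℤ.≟ 0ℤ) (¬sum ∘ proj₂ (odd⇒detected n odd)))
    (λ S≡0 sum → proj₁ (odd⇒detected n odd) sum S≡0)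

  n≡1⇒odd : ∀ n → n ℕ.% 4 ≡ 1 → ¬ 2 ℕ.∣ n
  n≡1⇒odd n n%4≡1 2∣n = case ℕ.∣1⇒≡1 (subst (2 ℕ.∣_) n%4≡1 (ℕ.%-presˡ-∣ 2∣n (ℕ.divides 2 refl))) of λ ()

open import Data.Nat using (ℕ; _<_; _*_; _+_; _%_)
open import Data.Integer using (+_)
open import Relation.Binary.PropositionalEquality using (_≡_; sym; subst)
open import Relation.Nullary using (¬_)
open import Function.Bundles using (_⇔_)

theorem5p1 : (n : ℕ) → 1 < n → n % 4 ≡ 1 →
    (¬ IsSumOfTwoSquares n) ⇔ (sumBelow n (λ x → jacobi (x * (x * x + 1)) n) ≡ + 0)
theorem5p1 n _ n%4≡1 = subst (λ s → (¬ IsSumOfTwoSquares n) ⇔ (s ≡ + 0))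
  (sym (sumBelow≡∑ n (λ x → jacobi (cubic x) n))) (nonSum⇔jacobiSum≡0 n (n≡1⇒odd n n%4≡1))
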